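{- Let $n_0(3)=4$, $n_0(4)=5$ and $n_0(6)=11$. Then for every $t\in\{3,4,6\}$ and every integer $n\ge n_0(t)$ with $\gcd(n,t)=1$, there exists a Universal Cycle for $t$-multisets of $[n]=\{1,\ldots,n\}$.
   Context: A Universal Cycle for $t$-multisets of $[n]$ (a $t$-Mcycle) is a cyclic sequence $a_1a_2\cdots a_k$ of $k=\binom{n+t-1}{t}$ entries from $[n]$ such that the $k$ multisets $\{a_i,a_{i+1},\ldots,a_{i+t-1}\}$ ($i=1,\ldots,k$, indices taken cyclically modulo $k$) are pairwise distinct; equivalently, every $t$-multiset of $[n]$ appears exactly once as the multiset of $t$ cyclically consecutive entries. -}

module Defs where

open import Data.Nat using (ℕ; zero; suc; _+_; _∸_; _≤_)
open import Data.Nat.DivMod using (_mod_)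
open import Data.Nat.Combinatorics using (_C_)
open import Data.Fin using (Fin; toℕ)
open import Data.List using (List; map; upTo)
open import Data.List.Relation.Binary.Permutation.Propositional using (_↭_)
open import Relation.Binary.PropositionalEquality using (_≢_)
open import Relation.Nullary using (¬_)

shiftMod : (k : ℕ) → Fin k → ℕ → Fin k
shiftMod (suc m) i j = (toℕ i + j) mod (suc m)

window : {n k : ℕ} → (t : ℕ) → (Fin k → Fin n) → Fin k → List (Fin n)
window {k = k} t a i = map (λ j → a (shiftMod k i j)) (upTo t)

SameMultiset : {n : ℕ} → List (Fin n) → List (Fin n) → Set
SameMultiset xs ys = xs ↭ ys

numMultisets : ℕ → ℕ → ℕ
numMultisets n t = (n + t ∸ 1) C t

IsMcycle : (n t : ℕ) → (Fin (numMultisets n t) → Fin n) → Set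
IsMcycle n t a = ∀ i j → i ≢ j → ¬ SameMultiset (window t a i) (window t a j)

MCycleExists : ℕ → ℕ → Set
MCycleExists n t = ∃Mc
  where
  open import Data.Product using (Σ)
  ∃Mc : Set
  ∃Mc = Σ (Fin (numMultisets n t) → Fin n) (IsMcycle n t)

-- n₀(t) as in the paper (only meaningful for t ∈ {3,4,6}).
n₀ : ℕ → ℕ
n₀ 3 = 4
n₀ 4 = 5
n₀ 6 = 11
n₀ _ = 0

{-# OPTIONS --safe #-}
module Submission where

-- Read [n] as ℤ/n. Going once around the circle through the elements of a
-- t-multiset gives a cyclic sequence of t differences with sum n, and
-- gcd(n, t) = 1 together with t ∈ {3, 4, 6} forces some difference to occur
-- exactly once. Choosing one such difference by a rule that only looks at the
-- multiset of differences, and cutting the circle there, turns every t-multiset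
-- into a word: a base point x followed by the t − 1 remaining differences d.
-- The words are the edges of a digraph on the (t−1)-tuples of points.
-- Since the rule is symmetric, rotating d permutes the edges, so the
-- edges split into closed walks; it remains to join these into one circuit,
-- i.e. to show that the graph is connected. Omitting the largest difference
-- that occurs once, any word whose omitted difference is positive is joined to
-- 0…0 by replacing letters by 0, a largest letter first; the few words whose
-- omitted difference is 0 consist of repeated letters only.

open import Defs
open import Data.Nat using (ℕ; zero; suc; pred; _+_; _*_; _∸_; _^_; _≤_; _<_; z≤n; s≤s; z<s; _%_; _≟_; _<?_; ⌊_/2⌋)
open import Data.Nat.Properties
open import Data.Nat.DivMod using (_mod_; m%n<n; m<n⇒m%n≡m; m%n%n≡m%n; [m+n]%n≡m%n; [m+kn]%n≡m%n; n%n≡0; %-distribˡ-+)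
open import Data.Nat.Divisibility using (_∣_; divides; ∣1⇒≡1)
open import Data.Nat.GCD using (gcd; gcd-greatest)
open import Data.Nat.Combinatorics using (nCn≡1; nCk+nC[k+1]≡[n+1]C[k+1]) renaming (_C_ to _choose_)
open import Data.Nat.ListAction using (sum)
open import Data.Nat.ListAction.Properties using (sum-++; sum-↭)
open import Data.Nat.Solver using (module +-*-Solver)
open +-*-Solver using (solve; _:+_; _:*_; _:=_; con)
open import Data.Fin using (Fin; zero; suc; toℕ; #_)
import Data.Fin.Properties as Fin
open import Data.Fin.Properties using (toℕ<n; toℕ-fromℕ<; toℕ-injective)
open import Data.List using (List; []; _∷_; _++_; _∷ʳ_; [_]; map; length; applyUpTo; upTo; lookup; replicate; initLast; _∷ʳ′_)
open import Data.List.Properties using (++-assoc; ++-identityʳ; length-++; length-map; ∷-injective; ∷ʳ-injective; map-∘; map-upTo; map-cong; length-replicate; ≡-dec)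
open import Data.List.Membership.Propositional using (_∈_; _∉_; find)
open import Data.List.Membership.Propositional.Properties using (∈-∃++; ∈-++⁺ˡ; ∈-++⁺ʳ; ∈-++⁻; ∈-map⁺; ∈-map⁻; ∈-applyUpTo⁺; ∈-applyUpTo⁻; ∈-lookup)
import Data.List.Membership.DecPropositional as DecMembership
open import Data.List.Relation.Unary.All as All using ([]; _∷_; all?)
open import Data.List.Relation.Unary.All.Properties using (¬All⇒Any¬)
open import Data.List.Relation.Unary.Any as Any using (here; there)
open import Data.List.Relation.Unary.Any.Properties using (lookup-index)
open import Data.List.Relation.Unary.AllPairs using ([]; _∷_)
open import Data.List.Relation.Unary.Linked using ([-]; _∷_)
open import Data.List.Relation.Unary.Sorted.TotalOrder ≤-totalOrder using (Sorted)
open import Data.List.Relation.Unary.Sorted.TotalOrder.Properties using (↗↭↗⇒≋)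
open import Data.List.Relation.Unary.Unique.Propositional using (Unique)
import Data.List.Relation.Unary.Unique.Propositional.Properties as Unique
open import Data.List.Relation.Binary.Pointwise using (Pointwise-≡⇒≡)
open import Data.List.Relation.Binary.Permutation.Propositional as Perm using (_↭_; prep; ↭-refl; ↭-sym; ↭-trans; ↭-reflexive; ↭⇒↭ₛ)
import Data.List.Relation.Binary.Permutation.Propositional.Properties as ↭
import Data.List.Relation.Binary.Permutation.Setoid.Properties as ↭ₛ
import Data.Vec as Vec
open import Data.Vec using ([]; _∷_)
open import Data.Product using (Σ; ∃; ∃₂; _×_; _,_; proj₁; proj₂)
import Data.Product.Properties as Product
open import Data.Sum using (_⊎_; inj₁; inj₂; [_,_]′)
open import Data.Empty using (⊥; ⊥-elim)
open import Function using (_∘_)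
open import Relation.Binary.Definitions using (DecidableEquality; tri<; tri≈; tri>)
open import Relation.Binary.PropositionalEquality using (_≡_; _≢_; refl; sym; ≢-sym; trans; cong; cong₂; subst; subst₂; setoid; module ≡-Reasoning)
open import Relation.Nullary using (¬_; Dec; yes; no)
open import Relation.Nullary.Decidable using (_×-dec_; _→-dec_; ¬?; from-yes)
open import Relation.Unary using (Decidable)

-- Lists without repetition and least witnesses

∈⇒↭∷ : {A : Set} {x : A} {xs : List A} → x ∈ xs → ∃ λ ys → xs ↭ x ∷ ys
∈⇒↭∷ {x = x} x∈xs with ys , zs , refl ← ∈-∃++ x∈xs = ys ++ zs , ↭.shift x ys zs

unique-⊆⇒length≤ : {A : Set} {xs ys : List A} → Unique xs →
  (∀ {z} → z ∈ xs → z ∈ ys) → length xs ≤ length ys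
unique-⊆⇒length≤ [] _ = z≤n
unique-⊆⇒length≤ {xs = x ∷ xs} (x# ∷ u) ⊆ys with zs , ys↭ ← ∈⇒↭∷ (⊆ys (here refl)) =
  ≤-trans (s≤s (unique-⊆⇒length≤ u inzs)) (≤-reflexive (sym (↭.↭-length ys↭)))
  where
  inzs : ∀ {z} → z ∈ xs → z ∈ zs
  inzs z∈ with ↭.∈-resp-↭ ys↭ (⊆ys (there z∈))
  ... | here refl = ⊥-elim (All.lookup x# z∈ refl)
  ... | there p   = p

unique-resp-↭ : {A : Set} {xs ys : List A} → xs ↭ ys → Unique xs → Unique ys
unique-resp-↭ {A} p = ↭ₛ.Unique-resp-↭ (setoid A) (↭⇒↭ₛ p)

least : {P : ℕ → Set} → Decidable P → ∀ {k} → P k → ∃ λ m → P m × (∀ {j} → j < m → ¬ P j)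
least P? {zero} p = 0 , p , λ ()
least P? {suc k} p with P? 0
... | yes p₀ = 0 , p₀ , λ ()
... | no ¬p₀ with m , pₘ , min ← least (P? ∘ suc) {k} p =
  suc m , pₘ , λ { {zero} _ → ¬p₀ ; {suc j} (s≤s j<m) → min j<m }

-- Eulerian circuits

-- The end of an edge `e` is `source (σ e)`, so the permutation `σ` matches each edge with one that
-- leaves its end. Hence the orbits of `σ` are closed walks, which can be spliced at common
-- vertices.
module Euler {A V : Set} (_≟_ : DecidableEquality A)
  (source : A → V) (σ : A → A) (P : A → Set) (L : List A)
  (complete : ∀ {e} → P e → e ∈ L) (sound : ∀ {e} → e ∈ L → P e)
  (σ-closed : ∀ {e} → P e → P (σ e))
  (σ-injective : ∀ {e f} → P e → P f → σ e ≡ σ f → e ≡ f)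
  where

  open DecMembership _≟_ using (_∈?_)

  -- After `e` any edge leaving its end may follow, not only `σ e`; splicing relies on this freedom.
  data Walk : V → List A → V → Set where
    []  : ∀ {v} → Walk v [] v
    _∷_ : ∀ e {es v} → Walk (source (σ e)) es v → Walk (source e) (e ∷ es) v

  infix 4 _~_
  data _~_ : A → A → Set where
    step    : ∀ {e} → P e → e ~ σ e
    join    : ∀ {e f} → P e → P f → source e ≡ source f → e ~ f
    ~-refl  : ∀ {e} → e ~ e
    ~-sym   : ∀ {e f} → e ~ f → f ~ e
    ~-trans : ∀ {e f g} → e ~ f → f ~ g → e ~ g

  _++ʷ_ : ∀ {u v w es fs} → Walk u es v → Walk v fs w → Walk u (es ++ fs) w
  []      ++ʷ q = q
  (e ∷ p) ++ʷ q = e ∷ (p ++ʷ q)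

  splitʷ : ∀ {u w g fs} es → Walk u (es ++ g ∷ fs) w →
    Walk u es (source g) × Walk (source g) (g ∷ fs) w
  splitʷ []       (g ∷ p) = [] , g ∷ p
  splitʷ (e ∷ es) (e ∷ p) with p₁ , p₂ ← splitʷ es p = e ∷ p₁ , p₂

  iterʷ : (g : ℕ → A) → (∀ i → g (suc i) ≡ σ (g i)) → ∀ m →
    Walk (source (g 0)) (applyUpTo g m) (source (g m))
  iterʷ g eq zero    = []
  iterʷ g eq (suc m) = g 0 ∷ subst (λ e → Walk (source e) (applyUpTo (g ∘ suc) m) (source (g (suc m))))
    (eq 0) (iterʷ (g ∘ suc) (eq ∘ suc) m)

  σ^ : ℕ → A → A
  σ^ zero    e = e
  σ^ (suc i) e = σ (σ^ i e)

  σ^-P : ∀ i {e} → P e → P (σ^ i e)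
  σ^-P zero    p = p
  σ^-P (suc i) p = σ-closed (σ^-P i p)

  σ^-cancel : ∀ i m {e} → P e → σ^ (i + m) e ≡ σ^ i e → σ^ m e ≡ e
  σ^-cancel zero    m p eq = eq
  σ^-cancel (suc i) m p eq = σ^-cancel i m p (σ-injective (σ^-P (i + m) p) (σ^-P i p) eq)

  -- Among `length L + 1` iterates two have the same index in `L`; since `σ` is injective, the
  -- coincidence can be pulled back to `e` itself.
  period : ∀ {e} → P e → ∃ λ m → σ^ (suc m) e ≡ e
  period {e} p with i , j , i<j , eq ← Fin.pigeonhole (n<1+n (length L)) (λ i → Any.index (complete (σ^-P (toℕ i) p)))
    with m , i+m≡j ← m≤n⇒∃[o]m+o≡n i<j =
    m , σ^-cancel (toℕ i) (suc m) p (trans (cong (λ k → σ^ k e) (trans (+-suc _ m) i+m≡j)) (sym same))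
    where
    same : σ^ (toℕ i) e ≡ σ^ (toℕ j) e
    same = trans (lookup-index (complete (σ^-P (toℕ i) p)))
      (trans (cong (lookup L) eq) (sym (lookup-index (complete (σ^-P (toℕ j) p)))))

  record Orbit (f : A) : Set where
    field
      elems   : List A
      walk    : Walk (source f) elems (source f)
      unique  : Unique elems
      start   : f ∈ elems
      iterate : ∀ {e} → e ∈ elems → ∃ λ i → e ≡ σ^ i f
      isP     : ∀ {e} → e ∈ elems → P e
      fwd     : ∀ {e} → e ∈ elems → σ e ∈ elems
      bwd     : ∀ {e} → P e → σ e ∈ elems → e ∈ elems

  orbit : ∀ {f} → P f → Orbit f
  orbit {f} p with k , eqₖ ← period p
    -- Stopping at the least period keeps the iterates distinct.
    with m , eq , min ← least (λ m → σ^ (suc m) f ≟ f) {k} eqₖ = record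
    { elems  = applyUpTo g (suc m)
    ; walk   = subst (λ e → Walk (source f) (applyUpTo g (suc m)) (source e)) eq (iterʷ g (λ _ → refl) (suc m))
    ; unique = Unique.applyUpTo⁺₁ g (suc m) distinct
    ; start  = ∈-applyUpTo⁺ g {0} z<s
    ; iterate = λ e∈ → let i , _ , eq = ∈-applyUpTo⁻ g e∈ in i , eq
    ; isP    = isP
    ; fwd    = fwd
    ; bwd    = bwd
    }
    where
    g : ℕ → A
    g i = σ^ i f
    distinct : ∀ {i j} → i < j → j < suc m → g i ≢ g j
    distinct {i} {j} i<j (s≤s j≤m) gi≡gj with o , i+o≡j ← m≤n⇒∃[o]m+o≡n i<j =
      min (<-≤-trans (≤-trans (s≤s (m≤n+m o i)) (≤-reflexive i+o≡j)) j≤m)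
        (σ^-cancel i (suc o) p (trans (cong g (trans (+-suc i o) i+o≡j)) (sym gi≡gj)))
    isP : ∀ {e} → e ∈ applyUpTo g (suc m) → P e
    isP e∈ with i , _ , refl ← ∈-applyUpTo⁻ g e∈ = σ^-P i p
    fwd : ∀ {e} → e ∈ applyUpTo g (suc m) → σ e ∈ applyUpTo g (suc m)
    fwd e∈ with i , s≤s i≤m , refl ← ∈-applyUpTo⁻ g e∈ with m≤n⇒m<n∨m≡n i≤m
    ... | inj₁ i<m  = ∈-applyUpTo⁺ g (s≤s i<m)
    ... | inj₂ refl = subst (_∈ applyUpTo g (suc m)) (sym eq) (∈-applyUpTo⁺ g {0} z<s)
    bwd : ∀ {e} → P e → σ e ∈ applyUpTo g (suc m) → e ∈ applyUpTo g (suc m)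
    bwd pe σe∈ with ∈-applyUpTo⁻ g σe∈
    ... | zero  , _ , σe≡ = subst (_∈ applyUpTo g (suc m))
      (sym (σ-injective pe (σ^-P m p) (trans σe≡ (sym eq)))) (∈-applyUpTo⁺ g (n<1+n m))
    ... | suc i , i<m , σe≡ = subst (_∈ applyUpTo g (suc m))
      (sym (σ-injective pe (σ^-P i p) σe≡)) (∈-applyUpTo⁺ g (<⇒≤ i<m))

  -- A circuit under construction. Being closed under `σ` in both directions, it is a union of
  -- orbits, so the orbit of an edge outside it is disjoint from it.
  record Closed (C : List A) : Set where
    field
      {base} : V
      walk   : Walk base C base
      unique : Unique C
      isP    : ∀ {e} → e ∈ C → P e
      fwd    : ∀ {e} → e ∈ C → σ e ∈ C
      bwd    : ∀ {e} → P e → σ e ∈ C → e ∈ C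

  Exit : List A → Set
  Exit C = ∃₂ λ g f → g ∈ C × f ∉ C × P f × source g ≡ source f

  -- Along a chain from `e` to `f`, membership in `C` can change only at a `join`, and such a change
  -- is an exit. Both directions are carried along because of `~-sym`.
  ~-exit : ∀ {C} → Closed C → ∀ {e f} → e ~ f → (e ∈ C → f ∈ C ⊎ Exit C) × (f ∈ C → e ∈ C ⊎ Exit C)
  ~-exit cl (step p) = inj₁ ∘ Closed.fwd cl , inj₁ ∘ Closed.bwd cl p
  ~-exit {C} cl {e} {f} (join pe pf eq) = to , from
    where
    to : e ∈ C → f ∈ C ⊎ Exit C
    to e∈ with f ∈? C
    ... | yes f∈ = inj₁ f∈
    ... | no  f∉ = inj₂ (e , f , e∈ , f∉ , pf , eq)
    from : f ∈ C → e ∈ C ⊎ Exit C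
    from f∈ with e ∈? C
    ... | yes e∈ = inj₁ e∈
    ... | no  e∉ = inj₂ (f , e , f∈ , e∉ , pe , sym eq)
  ~-exit cl ~-refl = inj₁ , inj₁
  ~-exit cl (~-sym q) with a , b ← ~-exit cl q = b , a
  ~-exit cl (~-trans q r) with a , b ← ~-exit cl q | c , d ← ~-exit cl r =
    (λ x → [ c , inj₂ ]′ (a x)) , (λ x → [ b , inj₂ ]′ (d x))

  -- The walk is interrupted just before `g` and runs once around the orbit of `f`, which starts and
  -- ends at the common source of `g` and `f`.
  insert : ∀ {C g f} → Closed C → g ∈ C → f ∉ C → P f → source g ≡ source f → Orbit f →
    ∃ λ C′ → Closed C′ × length C < length C′ × (∀ {e} → e ∈ C → e ∈ C′)
  insert {C} {g} {f} cl g∈ f∉ pf eq orb with es , fs , refl ← ∈-∃++ g∈ = C′ , cl′ , longer , ∈C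
    where
    module C = Closed cl
    open Orbit orb renaming (elems to O)
    C′ : List A
    C′ = es ++ O ++ g ∷ fs
    C′↭ : O ++ C ↭ C′
    C′↭ = ↭.shifts O es
    ∈O : ∀ {e} → e ∈ O → e ∈ C′
    ∈O = ↭.∈-resp-↭ C′↭ ∘ ∈-++⁺ˡ
    ∈C : ∀ {e} → e ∈ C → e ∈ C′
    ∈C = ↭.∈-resp-↭ C′↭ ∘ ∈-++⁺ʳ O
    ∈⁻ : ∀ {e} → e ∈ C′ → e ∈ O ⊎ e ∈ C
    ∈⁻ = ∈-++⁻ O ∘ ↭.∈-resp-↭ (↭-sym C′↭)
    -- The orbit of f misses C, since C is a union of orbits.
    missing : ∀ i → σ^ i f ∈ C → f ∈ C
    missing zero    f∈ = f∈
    missing (suc i) s∈ = missing i (C.bwd (σ^-P i pf) s∈)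
    longer : length C < length C′
    longer with ys , O↭ ← ∈⇒↭∷ start = ≤-trans
      (≤-trans (s≤s (m≤n+m (length C) (length ys)))
        (≤-reflexive (trans (cong (_+ length C) (sym (↭.↭-length O↭))) (sym (length-++ O)))))
      (≤-reflexive (↭.↭-length C′↭))
    disjoint : ∀ {e} → ¬ (e ∈ O × e ∈ C)
    disjoint (e∈O , e∈C) with i , refl ← iterate e∈O = f∉ (missing i e∈C)
    cl′ : Closed C′
    cl′ with p , q ← splitʷ es C.walk = record
      { walk   = p ++ʷ (subst (λ v → Walk v O v) (sym eq) walk ++ʷ q)
      ; unique = unique-resp-↭ C′↭ (Unique.++⁺ unique C.unique disjoint)
      ; isP    = λ e∈ → [ isP , C.isP ]′ (∈⁻ e∈)
      ; fwd    = λ e∈ → [ ∈O ∘ fwd , ∈C ∘ C.fwd ]′ (∈⁻ e∈)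
      ; bwd    = λ pe σe∈ → [ ∈O ∘ bwd pe , ∈C ∘ C.bwd pe ]′ (∈⁻ σe∈)
      }

  extend : ∀ {C} → Closed C → Exit C → ∃ λ C′ → Closed C′ × length C < length C′ × (∀ {e} → e ∈ C → e ∈ C′)
  extend cl (g , f , g∈ , f∉ , pf , eq) = insert cl g∈ f∉ pf eq (orbit pf)

  orbit-closed : ∀ {f} (O : Orbit f) → Closed (Orbit.elems O)
  orbit-closed O = record { Orbit O }

  -- As long as an edge of `L` is missing, its connection to `e₀` provides an exit, and the circuit
  -- grows.
  circuit : ∀ {e₀} → P e₀ → (∀ {f} → P f → e₀ ~ f) → Unique L →
    ∃₂ λ C v → Walk v C v × Unique C × (∀ {e} → e ∈ C → P e) × length C ≡ length L
  circuit {e₀} p₀ connected L! = go (suc (length L)) start (orbit-closed (orbit p₀)) (m≤n+m _ (length elems))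
    where
    open Orbit (orbit p₀) using (elems; start)
    go : ∀ fuel {C} → e₀ ∈ C → Closed C → length L < length C + fuel →
      ∃₂ λ C v → Walk v C v × Unique C × (∀ {e} → e ∈ C → P e) × length C ≡ length L
    -- Every insertion lengthens `C`, so when the fuel is spent `C` would be longer than `L`, which
    -- contains it.
    go zero {C} e₀∈ cl lt = ⊥-elim (<⇒≱ (subst (length L <_) (+-identityʳ _) lt)
      (unique-⊆⇒length≤ unique (complete ∘ isP)))
      where open Closed cl
    go (suc fuel) {C} e₀∈ cl lt with all? (_∈? C) L
    ... | yes all = C , base , walk , unique , isP ,
      ≤-antisym (unique-⊆⇒length≤ unique (complete ∘ isP)) (unique-⊆⇒length≤ L! (All.lookup all))
      where open Closed cl
    ... | no ¬all with f , f∈L , f∉C ← find (¬All⇒Any¬ (_∈? C) L ¬all)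
      with proj₁ (~-exit cl (connected (sound f∈L))) e₀∈
    ... | inj₁ f∈C = ⊥-elim (f∉C f∈C)
    ... | inj₂ exit with C′ , cl′ , longer , C⊆C′ ← extend cl exit =
      go fuel (C⊆C′ e₀∈) cl′ (<-≤-trans lt (≤-trans (≤-reflexive (+-suc _ fuel)) (+-monoˡ-≤ fuel longer)))

-- Stars and bars, and counting by representatives

increment : List ℕ → List ℕ
increment []       = []
increment (x ∷ xs) = suc x ∷ xs

increment-injective : ∀ {xs ys} → increment xs ≡ increment ys → xs ≡ ys
increment-injective {[]}    {[]}    eq   = refl
increment-injective {_ ∷ _} {_ ∷ _} refl = refl

-- With `N` = n - 1, the entries stand for the least element and the successive gaps of a sorted
-- multiset of numbers below n. The first entry is 0 or can be lowered by 1, which is Pascal's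
-- recursion.
boundedSums : ℕ → ℕ → List (List ℕ)
boundedSums zero    N       = [ [] ]
boundedSums (suc t) zero    = map (0 ∷_) (boundedSums t zero)
boundedSums (suc t) (suc N) = map (0 ∷_) (boundedSums t (suc N)) ++ map increment (boundedSums (suc t) N)

length-boundedSums : ∀ t N → length (boundedSums t N) ≡ (N + t) choose t
length-boundedSums zero N = refl
length-boundedSums (suc t) zero = trans (length-map (0 ∷_) (boundedSums t zero))
  (trans (length-boundedSums t zero) (trans (nCn≡1 t) (sym (nCn≡1 (suc t)))))
length-boundedSums (suc t) (suc N) = begin
  length (map (0 ∷_) (boundedSums t (suc N)) ++ map increment (boundedSums (suc t) N))
    ≡⟨ length-++ (map (0 ∷_) (boundedSums t (suc N))) ⟩
  length (map (0 ∷_) (boundedSums t (suc N))) + length (map increment (boundedSums (suc t) N))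
    ≡⟨ cong₂ _+_ (length-map (0 ∷_) (boundedSums t (suc N))) (length-map increment (boundedSums (suc t) N)) ⟩
  length (boundedSums t (suc N)) + length (boundedSums (suc t) N)
    ≡⟨ cong₂ _+_ (length-boundedSums t (suc N)) (length-boundedSums (suc t) N) ⟩
  (suc N + t) choose t + (N + suc t) choose suc t
    ≡⟨ cong (λ k → k choose t + (N + suc t) choose suc t) (sym (+-suc N t)) ⟩
  (N + suc t) choose t + (N + suc t) choose suc t
    ≡⟨ nCk+nC[k+1]≡[n+1]C[k+1] (N + suc t) t ⟩
  (suc N + suc t) choose suc t ∎
  where open ≡-Reasoning

boundedSums-unique : ∀ t N → Unique (boundedSums t N)
boundedSums-unique zero    N       = [] ∷ []
boundedSums-unique (suc t) zero    = Unique.map⁺ (λ eq → proj₂ (∷-injective eq)) (boundedSums-unique t zero)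
boundedSums-unique (suc t) (suc N) = Unique.++⁺
  (Unique.map⁺ (λ eq → proj₂ (∷-injective eq)) (boundedSums-unique t (suc N)))
  (Unique.map⁺ increment-injective (boundedSums-unique (suc t) N))
  disjoint
  where
  disjoint : ∀ {l} → ¬ (l ∈ map (0 ∷_) (boundedSums t (suc N)) × l ∈ map increment (boundedSums (suc t) N))
  disjoint (p , q) with ∈-map⁻ (0 ∷_) p | ∈-map⁻ increment q
  ... | _ , _ , refl | [] , _ , ()
  ... | _ , _ , refl | _ ∷ _ , _ , ()

∈-boundedSums⁻ : ∀ t N {l} → l ∈ boundedSums t N → length l ≡ t × sum l ≤ N
∈-boundedSums⁻ zero    N       (here refl) = refl , z≤n
∈-boundedSums⁻ (suc t) zero    l∈ = prepend (∈-map⁻ (0 ∷_) l∈)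
  where
  prepend : ∀ {l} → (∃ λ l′ → l′ ∈ boundedSums t zero × l ≡ 0 ∷ l′) → length l ≡ suc t × sum l ≤ zero
  prepend (l , l∈ , refl) with len , s ← ∈-boundedSums⁻ t zero l∈ = cong suc len , s
∈-boundedSums⁻ (suc t) (suc N) l∈ =
  [ prepend ∘ ∈-map⁻ (0 ∷_) , raise ∘ ∈-map⁻ increment ]′ (∈-++⁻ (map (0 ∷_) (boundedSums t (suc N))) l∈)
  where
  prepend : ∀ {l} → (∃ λ l′ → l′ ∈ boundedSums t (suc N) × l ≡ 0 ∷ l′) → length l ≡ suc t × sum l ≤ suc N
  prepend (l , l∈ , refl) with len , s ← ∈-boundedSums⁻ t (suc N) l∈ = cong suc len , s
  raise : ∀ {l} → (∃ λ l′ → l′ ∈ boundedSums (suc t) N × l ≡ increment l′) → length l ≡ suc t × sum l ≤ suc N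
  raise ([] , l∈ , refl) with () ← proj₁ (∈-boundedSums⁻ (suc t) N l∈)
  raise (x ∷ l , l∈ , refl) with len , s ← ∈-boundedSums⁻ (suc t) N l∈ = len , s≤s s

∈-boundedSums⁺ : ∀ t N l → length l ≡ t → sum l ≤ N → l ∈ boundedSums t N
∈-boundedSums⁺ zero    N       []          refl s = here refl
∈-boundedSums⁺ (suc t) zero    (zero ∷ l)  refl s = ∈-map⁺ (0 ∷_) (∈-boundedSums⁺ t zero l refl s)
∈-boundedSums⁺ (suc t) (suc N) (zero ∷ l)  refl s = ∈-++⁺ˡ (∈-map⁺ (0 ∷_) (∈-boundedSums⁺ t (suc N) l refl s))
∈-boundedSums⁺ (suc t) (suc N) (suc x ∷ l) refl (s≤s s) =
  ∈-++⁺ʳ (map (0 ∷_) (boundedSums t (suc N))) (∈-map⁺ increment (∈-boundedSums⁺ (suc t) N (x ∷ l) refl s))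

-- Serves to count the edges through sorted multisets: one `e` is picked for each `s`, and as no `e`
-- serves two of them, the picked list has no repetition.
representatives : {X A : Set} (Q : X → A → Set) (S : List X) → Unique S →
  (∀ {s} → s ∈ S → ∃ (Q s)) →
  (∀ {s s′ e} → s ∈ S → s′ ∈ S → Q s e → Q s′ e → s ≡ s′) →
  ∃ λ L → length L ≡ length S × Unique L × (∀ {e} → e ∈ L → ∃ λ s → s ∈ S × Q s e)
    × (∀ {s} → s ∈ S → ∃ λ e → e ∈ L × Q s e)
representatives Q [] S! total injective = [] , refl , [] , (λ ()) , λ ()
representatives Q (s ∷ S) (s# ∷ S!) total injective
  with L , len , L! , sound , complete ← representatives Q S S! (total ∘ there) (λ p q → injective (there p) (there q))
  with e , q ← total (here refl) =
  e ∷ L , cong suc len , All.tabulate fresh ∷ L!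
  , (λ { (here refl) → s , here refl , q ; (there p) → let s′ , s′∈ , q′ = sound p in s′ , there s′∈ , q′ })
  , λ { (here refl) → e , here refl , q ; (there p) → let e′ , e′∈ , q′ = complete p in e′ , there e′∈ , q′ }
  where
  fresh : ∀ {e′} → e′ ∈ L → e ≢ e′
  fresh e′∈ refl with s′ , s′∈ , q′ ← sound e′∈ = All.lookup s# s′∈ (injective (here refl) (there s′∈) q q′)

-- On both sides the displayed `r` is the first occurrence of `r`, so its position is determined.
split-unique : {A : Set} {r : A} (as {as′ bs bs′} : List A) → r ∉ as → r ∉ as′ →
  as ++ r ∷ bs ≡ as′ ++ r ∷ bs′ → as ≡ as′ × bs ≡ bs′
split-unique []       {[]}      r∉ r∉′ refl = refl , refl
split-unique []       {x ∷ as′} r∉ r∉′ refl = ⊥-elim (r∉′ (here refl))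
split-unique (x ∷ as) {[]}      r∉ r∉′ refl = ⊥-elim (r∉ (here refl))
split-unique (x ∷ as) {y ∷ as′} r∉ r∉′ eq with refl , eq′ ← ∷-injective eq
  with refl , refl ← split-unique as (r∉ ∘ there) (r∉′ ∘ there) eq′ = refl , refl

-- Points on the cycle ℤ/n with prescribed successive differences

module Points (N : ℕ) where

  n : ℕ
  n = suc N

  %-congˡ-+ : ∀ x y z → x % n ≡ y % n → (x + z) % n ≡ (y + z) % n
  %-congˡ-+ x y z eq = trans (%-distribˡ-+ x z n)
    (trans (cong (λ w → (w + z % n) % n) eq) (sym (%-distribˡ-+ y z n)))

  [m%n+k]%n : ∀ m k → (m % n + k) % n ≡ (m + k) % n
  [m%n+k]%n m k = %-congˡ-+ (m % n) m k (m%n%n≡m%n m n)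

  -- Adding `z * N` undoes adding `z`, because `z + z * N` is the multiple `z * n`.
  %-cancelʳ-+ : ∀ {x y} z → x < n → y < n → (x + z) % n ≡ (y + z) % n → x ≡ y
  %-cancelʳ-+ {x} {y} z x<n y<n eq = trans (sym (lemma x<n)) (trans (%-congˡ-+ (x + z) (y + z) (z * N) eq) (lemma y<n))
    where
    lemma : ∀ {x} → x < n → (x + z + z * N) % n ≡ x
    lemma {x} x<n = trans (cong (_% n) (trans (+-assoc x z (z * N)) (cong (x +_) (sym (*-suc z N)))))
      (trans ([m+kn]%n≡m%n x z n) (m<n⇒m%n≡m x<n))

  points : ℕ → List ℕ → List ℕ
  points x []       = [ x % n ]
  points x (d ∷ ds) = x % n ∷ points (x + d) ds

  -- The end point is left out: when the differences close up, the last step returns to the start,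
  -- so this is the list that can be rotated.
  cyclePoints : ℕ → List ℕ → List ℕ
  cyclePoints x []       = []
  cyclePoints x (d ∷ ds) = x % n ∷ cyclePoints (x + d) ds

  points≡cyclePoints : ∀ x ds z → points x ds ≡ cyclePoints x (ds ∷ʳ z)
  points≡cyclePoints x []       z = refl
  points≡cyclePoints x (d ∷ ds) z = cong (x % n ∷_) (points≡cyclePoints (x + d) ds z)

  cyclePoints-++ : ∀ x p q → cyclePoints x (p ++ q) ≡ cyclePoints x p ++ cyclePoints (x + sum p) q
  cyclePoints-++ x []      q = cong (λ y → cyclePoints y q) (sym (+-identityʳ x))
  cyclePoints-++ x (d ∷ p) q = cong (x % n ∷_) (trans (cyclePoints-++ (x + d) p q)
    (cong (λ y → cyclePoints (x + d) p ++ cyclePoints y q) (+-assoc x d (sum p))))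

  cyclePoints-cong : ∀ x y p → x % n ≡ y % n → cyclePoints x p ≡ cyclePoints y p
  cyclePoints-cong x y []      eq = refl
  cyclePoints-cong x y (d ∷ p) eq = cong₂ _∷_ eq (cyclePoints-cong (x + d) (y + d) p (%-congˡ-+ x y d eq))

  points-cong : ∀ x y p → x % n ≡ y % n → points x p ≡ points y p
  points-cong x y []      eq = cong [_] eq
  points-cong x y (d ∷ p) eq = cong₂ _∷_ eq (points-cong (x + d) (y + d) p (%-congˡ-+ x y d eq))

  %-ascend : ∀ x d → x + d < n → x % n ≤ (x + d) % n
  %-ascend x d lt rewrite m<n⇒m%n≡m lt | m<n⇒m%n≡m (≤-<-trans (m≤m+n x d) lt) = m≤m+n x d

  points-sorted : ∀ x ds → x + sum ds < n → Sorted (points x ds)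
  points-sorted x []            lt = [-]
  points-sorted x (d ∷ [])      lt = %-ascend x d (≤-<-trans (+-monoʳ-≤ x (m≤m+n d 0)) lt) ∷ [-]
  points-sorted x (d ∷ d′ ∷ ds) lt = %-ascend x d (≤-<-trans (+-monoʳ-≤ x (m≤m+n d _)) lt)
    ∷ points-sorted (x + d) (d′ ∷ ds) (subst (_< n) (sym (+-assoc x d _)) lt)

  points-injective : ∀ {x y} ds es → x + sum ds < n → y + sum es < n →
    points x ds ≡ points y es → x ≡ y × ds ≡ es
  points-injective {x} {y} ds es lt lt′ eq = go ds es lt lt′ eq
    where
    residue : ∀ {z k} → z + k < n → z % n ≡ z
    residue {z} {k} lt = m<n⇒m%n≡m (≤-<-trans (m≤m+n z k) lt)
    head≡ : ∀ x y {u v a b} → x + a < n → y + b < n → x % n ∷ u ≡ y % n ∷ v → x ≡ y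
    head≡ _ _ p q eq = trans (sym (residue p)) (trans (proj₁ (∷-injective eq)) (residue q))
    go : ∀ {x y} ds es → x + sum ds < n → y + sum es < n → points x ds ≡ points y es → x ≡ y × ds ≡ es
    go []           []           p q eq = head≡ _ _ p q eq , refl
    go []           (_ ∷ [])     p q ()
    go []           (_ ∷ _ ∷ _)  p q ()
    go (_ ∷ [])     []           p q ()
    go (_ ∷ _ ∷ _)  []           p q ()
    go {x} {y} (d ∷ ds) (e ∷ es) p q eq with refl ← head≡ x y p q eq
      with x+d≡ , refl ← go ds es (subst (_< n) (sym (+-assoc x d _)) p)
        (subst (_< n) (sym (+-assoc x e _)) q) (proj₂ (∷-injective eq)) =
      refl , cong (_∷ ds) (+-cancelˡ-≡ x d e x+d≡)

  -- As long as no sum reaches `n`, the point lists are sorted, and sorted lists that are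
  -- permutations of each other are equal.
  sorted-points-injective : ∀ {x y} ds es → x + sum ds < n → y + sum es < n →
    points x ds ↭ points y es → x ≡ y × ds ≡ es
  sorted-points-injective {x} {y} ds es p q perm = points-injective ds es p q
    (Pointwise-≡⇒≡ (↗↭↗⇒≋ ≤-totalOrder (points-sorted x ds p) (points-sorted y es q) (↭⇒↭ₛ perm)))

  -- z closes the cycle y, y + g₁, …; in points x (bs ++ as) the cycle is cut at r instead.
  points-rotate : ∀ {x} y g {z} as r bs → g ∷ʳ z ≡ as ++ r ∷ bs → sum (g ∷ʳ z) ≡ n →
    x % n ≡ (y + (sum as + r)) % n → points x (bs ++ as) ↭ points y g
  points-rotate {x} y g {z} as r bs eq total x≡ = begin
    points x (bs ++ as)                          ≡⟨ points≡cyclePoints x (bs ++ as) r ⟩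
    cyclePoints x ((bs ++ as) ∷ʳ r)              ≡⟨ cong (cyclePoints x) (++-assoc bs as [ r ]) ⟩
    cyclePoints x (bs ++ as ∷ʳ r)                ≡⟨ cyclePoints-++ x bs (as ∷ʳ r) ⟩
    cyclePoints x bs ++ cyclePoints (x + sum bs) (as ∷ʳ r)
      ≡⟨ cong₂ _++_ (cyclePoints-cong x _ bs x≡′) (cyclePoints-cong (x + sum bs) y (as ∷ʳ r) wrap) ⟩
    cyclePoints (y + sum (as ∷ʳ r)) bs ++ cyclePoints y (as ∷ʳ r)
      ↭⟨ ↭.++-comm (cyclePoints (y + sum (as ∷ʳ r)) bs) _ ⟩
    cyclePoints y (as ∷ʳ r) ++ cyclePoints (y + sum (as ∷ʳ r)) bs
      ≡⟨ cyclePoints-++ y (as ∷ʳ r) bs ⟨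
    cyclePoints y (as ∷ʳ r ++ bs)                ≡⟨ cong (cyclePoints y) (trans (++-assoc as [ r ] bs) (sym eq)) ⟩
    cyclePoints y (g ∷ʳ z)                       ≡⟨ points≡cyclePoints y g z ⟨
    points y g                                   ∎
    where
    open Perm.PermutationReasoning
    sum-as∷ʳr : sum (as ∷ʳ r) ≡ sum as + r
    sum-as∷ʳr = trans (sum-++ as [ r ]) (cong (sum as +_) (+-identityʳ r))
    x≡′ : x % n ≡ (y + sum (as ∷ʳ r)) % n
    x≡′ = trans x≡ (cong (λ k → (y + k) % n) (sym sum-as∷ʳr))
    total′ : sum (as ∷ʳ r) + sum bs ≡ n
    total′ = trans (sym (sum-++ (as ∷ʳ r) bs)) (trans (cong sum (trans (++-assoc as [ r ] bs) (sym eq))) total)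
    wrap : (x + sum bs) % n ≡ y % n
    wrap = trans (%-congˡ-+ x (y + sum (as ∷ʳ r)) (sum bs) x≡′)
      (trans (cong (_% n) (trans (+-assoc y _ (sum bs)) (cong (y +_) total′))) ([m+n]%n≡m%n y n))

  -- `q` is the step that carries the partial sums to `n` or beyond, i.e. past 0 on the circle.
  wrap-split : ∀ x ds → x < n → n ≤ x + sum ds →
    ∃₂ λ ps q → ∃ λ qs → ds ≡ ps ++ q ∷ qs × x + sum ps < n × n ≤ x + sum ps + q
  wrap-split x [] x<n le = ⊥-elim (<⇒≱ x<n (subst (n ≤_) (+-identityʳ x) le))
  wrap-split x (d ∷ ds) x<n le with x + d <? n
  ... | no ≮ = [] , d , ds , refl , subst (_< n) (sym (+-identityʳ x)) x<n
    , subst (λ k → n ≤ k + d) (sym (+-identityʳ x)) (≮⇒≥ ≮)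
  ... | yes lt with ps , q , qs , refl , p₁ , p₂ ← wrap-split (x + d) ds lt (subst (n ≤_) (sym (+-assoc x d _)) le) =
    d ∷ ps , q , qs , refl , subst (_< n) (+-assoc x d _) p₁ , subst (λ k → n ≤ k + q) (+-assoc x d _) p₂

-- Auxiliary facts on lists and sums

lookup-unique : {A : Set} {xs : List A} → Unique xs → ∀ {i j} → lookup xs i ≡ lookup xs j → i ≡ j
lookup-unique {xs = x ∷ xs} (x# ∷ u) {zero}  {zero}  eq = refl
lookup-unique {xs = x ∷ xs} (x# ∷ u) {zero}  {suc j} eq = ⊥-elim (All.lookup x# (∈-lookup j) eq)
lookup-unique {xs = x ∷ xs} (x# ∷ u) {suc i} {zero}  eq = ⊥-elim (All.lookup x# (∈-lookup i) (sym eq))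
lookup-unique {xs = x ∷ xs} (x# ∷ u) {suc i} {suc j} eq = cong suc (lookup-unique u eq)

dropLast : {A : Set} → List A → List A
dropLast []           = []
dropLast (x ∷ [])     = []
dropLast (x ∷ y ∷ ys) = x ∷ dropLast (y ∷ ys)

dropLast-∷ʳ : {A : Set} (xs : List A) (y : A) → dropLast (xs ∷ʳ y) ≡ xs
dropLast-∷ʳ []           y = refl
dropLast-∷ʳ (x ∷ [])     y = refl
dropLast-∷ʳ (x ∷ z ∷ xs) y = cong (x ∷_) (dropLast-∷ʳ (z ∷ xs) y)

sum-∷ʳ : ∀ xs x → sum (xs ∷ʳ x) ≡ sum xs + x
sum-∷ʳ xs x = trans (sum-++ xs [ x ]) (cong (sum xs +_) (+-identityʳ x))

length-∷ʳ : {A : Set} (xs : List A) (x : A) → length (xs ∷ʳ x) ≡ suc (length xs)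
length-∷ʳ xs x = trans (length-++ xs) (+-comm (length xs) 1)

rearrange : ∀ a b c d → a + (b + c) + d ≡ c + (d + a) + b
rearrange = solve 4 (λ a b c d → a :+ (b :+ c) :+ d := c :+ (d :+ a) :+ b) refl

shuffle : ∀ a b c → a + b + c ≡ a + c + b
shuffle = solve 3 (λ a b c → a :+ b :+ c := a :+ c :+ b) refl

regroup : ∀ a b c d e → a + b + c + (d + e) ≡ a + (b + (c + d) + e)
regroup = solve 5 (λ a b c d e → a :+ b :+ c :+ (d :+ e) := a :+ (b :+ (c :+ d) :+ e)) refl

maximum : ∀ x xs → ∃ λ c → c ∈ x ∷ xs × (∀ {y} → y ∈ x ∷ xs → y ≤ c)
maximum x [] = x , here refl , λ { (here refl) → ≤-refl }
maximum x (y ∷ ys) with c , c∈ , max ← maximum y ys with ≤-total x c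
... | inj₁ x≤c = c , there c∈ , λ { (here refl) → x≤c ; (there p) → max p }
... | inj₂ c≤x = x , here refl , λ { (here refl) → ≤-refl ; (there p) → ≤-trans (max p) c≤x }

-- Lets the sequence be indexed by the length of a circuit instead of a binomial coefficient.
mcycle-of-length : ∀ {n t k} → k ≡ numMultisets n t →
  (Σ (Fin k → Fin n) λ a → ∀ i j → i ≢ j → ¬ SameMultiset (window t a i) (window t a j)) → MCycleExists n t
mcycle-of-length refl m = m

-- The digraph of words for an abstract rule of omission

module Construction (N ℓ′ : ℕ) (3≤n : 3 ≤ suc N)
  -- `V d` stands for: the rule omits n - `sum d` from the multiset of differences formed by `d` and
  -- this number. The last two hypotheses serve connectivity: one supplies the words next to 0...0,
  -- the other leads away from a word that omits 0.
  (V : List ℕ → Set)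
  (V-resp-↭ : ∀ {d d′} → d ↭ d′ → V d → V d′)
  (V-exists : ∀ M → length M ≡ 3 + ℓ′ → sum M ≡ suc N → ∃₂ λ r d → M ↭ r ∷ d × V d)
  (V-fresh : ∀ {r d} → r + sum d ≡ suc N → V d → r ∉ d)
  (V-unique : ∀ {r r′ d d′} → r ∷ d ↭ r′ ∷ d′ → r + sum d ≡ suc N → V d → V d′ → r ≡ r′)
  (V-strict : ∀ {d} → 0 ∈ d → (∀ {y} → y ∈ d → y + sum d < suc N) → V d)
  (V-tight : ∀ {d} → length d ≡ 2 + ℓ′ → sum d ≡ suc N → V d →
    ∃₂ λ u v → ∃ λ w → d ↭ u ∷ w × V (v ∷ w) × v + sum w < suc N)
  where

  open Points N

  ℓ : ℕ
  ℓ = 2 + ℓ′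

  Edge : Set
  Edge = ℕ × List ℕ

  _≟ₑ_ : DecidableEquality Edge
  _≟ₑ_ = Product.≡-dec _≟_ (≡-dec _≟_)

  Word : List ℕ → Set
  Word d = length d ≡ ℓ × sum d ≤ n × V d

  Valid : Edge → Set
  Valid (x , d) = x < n × Word d

  -- A vertex records the first t - 1 points of an edge. The source of `σ e` then records the last t
  -- - 1 points of `e`.
  source : Edge → Edge
  source (x , d) = x , dropLast d

  σ : Edge → Edge
  σ (x , [])     = x , []
  σ (x , d ∷ ds) = (x + d) % n , ds ∷ʳ d

  word-resp-↭ : ∀ {d d′} → d ↭ d′ → Word d → Word d′
  word-resp-↭ p (len , s , v) =
    trans (↭.↭-length (↭-sym p)) len , subst (_≤ n) (sum-↭ p) s , V-resp-↭ p v

  σ-valid : ∀ {e} → Valid e → Valid (σ e)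
  σ-valid {x , d ∷ ds} (x<n , w) = m%n<n (x + d) n , word-resp-↭ (↭.∷↭∷ʳ d ds) w

  σ-injective : ∀ {e f} → Valid e → Valid f → σ e ≡ σ f → e ≡ f
  σ-injective {x , d ∷ ds} {y , d′ ∷ ds′} (x<n , _) (y<n , _) eq
    with refl , refl ← ∷ʳ-injective ds ds′ (cong proj₂ eq) =
    cong (_, d ∷ ds) (%-cancelʳ-+ d x<n y<n (cong proj₁ eq))

  -- Sorted multisets: (y ∷ g) has its elements y, y + g₁, y + g₁ + g₂, … all below n.

  Rotation : List ℕ → Edge → Set
  Rotation []      e       = ⊥
  -- Around the circle the differences are `g` and the closing gap. The circle is cut at `r`: the
  -- base point is the point right after `r`, and the word lists the other differences from there.
  Rotation (y ∷ g) (x , d) = ∃₂ λ as r → ∃ λ bs →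
    g ∷ʳ (n ∸ sum g) ≡ as ++ r ∷ bs × d ≡ bs ++ as × x ≡ (y + (sum as + r)) % n

  closed-sum : ∀ {g} → sum g ≤ n → sum (g ∷ʳ (n ∸ sum g)) ≡ n
  closed-sum {g} le = trans (sum-∷ʳ g _) (m+[n∸m]≡n le)

  rotation-sum : ∀ {g} as r bs → sum g ≤ n → g ∷ʳ (n ∸ sum g) ≡ as ++ r ∷ bs → r + sum (bs ++ as) ≡ n
  rotation-sum {g} as r bs le eq = begin
    r + sum (bs ++ as)      ≡⟨ cong (r +_) (sum-↭ (↭.++-comm bs as)) ⟩
    sum (r ∷ as ++ bs)      ≡⟨ sum-↭ (↭.shift r as bs) ⟨
    sum (as ++ r ∷ bs)      ≡⟨ cong sum eq ⟨
    sum (g ∷ʳ (n ∸ sum g))  ≡⟨ closed-sum {g} le ⟩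
    n                       ∎
    where open ≡-Reasoning

  sorted⇒sum≤ : ∀ y g → y + sum g ≤ N → sum g ≤ n
  sorted⇒sum≤ y g le = ≤-trans (m≤n+m (sum g) y) (≤-trans le (n≤1+n N))

  rotation-points : ∀ {y g x d} → y + sum g ≤ N → Rotation (y ∷ g) (x , d) → points x d ↭ points y g
  rotation-points {y} {g} le (as , r , bs , eq , refl , refl) =
    points-rotate y g as r bs eq (closed-sum {g} (sorted⇒sum≤ y g le)) (m%n%n≡m%n (y + (sum as + r)) n)

  rotation-exists : ∀ {y g} → length g ≡ ℓ → y + sum g ≤ N → ∃ λ e → Valid e × Rotation (y ∷ g) e
  rotation-exists {y} {g} len le
    with r , d , D↭ , v ← V-exists (g ∷ʳ (n ∸ sum g)) (trans (length-∷ʳ g _) (cong suc len)) (closed-sum {g} (sorted⇒sum≤ y g le))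
    with as , bs , eq ← ∈-∃++ (↭.∈-resp-↭ (↭-sym D↭) (here refl)) =
    ((y + (sum as + r)) % n , bs ++ as) ,
    (m%n<n (y + (sum as + r)) n , lenw , subst (sum (bs ++ as) ≤_) (rotation-sum {g} as r bs (sorted⇒sum≤ y g le) eq) (m≤n+m _ r) , V-resp-↭ d↭ v) ,
    as , r , bs , eq , refl , refl
    where
    d↭ : d ↭ bs ++ as
    d↭ = ↭-trans (↭.drop-∷ (↭-trans (↭-sym D↭) (↭-trans (↭-reflexive eq) (↭.shift r as bs)))) (↭.++-comm as bs)
    lenw : length (bs ++ as) ≡ ℓ
    lenw = trans (↭.↭-length (↭-sym d↭)) (suc-injective
      (trans (sym (↭.↭-length D↭)) (trans (length-∷ʳ g _) (cong suc len))))

  -- `V-unique` fixes the omitted difference; by `V-fresh` it occurs only once, so the place of the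
  -- cut is fixed too.
  rotation-unique : ∀ {y g e f} → y + sum g ≤ N → Valid e → Valid f →
    Rotation (y ∷ g) e → Rotation (y ∷ g) f → e ≡ f
  rotation-unique {y} {g} le (_ , _ , _ , v) (_ , _ , _ , v′)
    (as , r , bs , eq , refl , refl) (as′ , r′ , bs′ , eq′ , refl , refl)
    with refl ← V-unique
      (↭-trans (prep r (↭.++-comm bs as)) (↭-trans (↭-sym (↭.shift r as bs)) (↭-trans (↭-reflexive (trans (sym eq) eq′))
        (↭-trans (↭.shift r′ as′ bs′) (prep r′ (↭.++-comm as′ bs′))))))
      (rotation-sum {g} as r bs (sorted⇒sum≤ y g le) eq) v v′
    with refl , refl ← split-unique as
      (V-fresh (rotation-sum {g} as r bs (sorted⇒sum≤ y g le) eq) v ∘ ∈-++⁺ʳ bs)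
      (V-fresh (rotation-sum {g} as′ r bs′ (sorted⇒sum≤ y g le) eq′) v′ ∘ ∈-++⁺ʳ bs′)
      (trans (sym eq) eq′) = refl

  sorted-form : ∀ {e} → Valid e → ∃₂ λ y g → length g ≡ ℓ × y + sum g ≤ N × Rotation (y ∷ g) e
  sorted-form {x , d} (x<n , len , s≤n , v) with x + sum d <? n
  -- No step passes 0: the word already lists the gaps upwards from `x`, and the omitted difference
  -- is the closing gap.
  ... | yes lt = x , d , len , ≤-pred lt , d , n ∸ sum d , [] , refl , refl ,
    sym (trans (cong (λ k → (x + k) % n) (m+[n∸m]≡n s≤n)) (trans ([m+n]%n≡m%n x n) (m<n⇒m%n≡m x<n)))
  -- The step `q` passes 0, so the least point is the one after `q`. From there the gaps are `qs`,
  -- the omitted `r` and `ps`, and `q` closes the circle.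
  ... | no ≮ with ps , q , qs , refl , lt , le ← wrap-split x d x<n (≮⇒≥ ≮) = y , g , leng , sumg , qs , r , ps ∷ʳ q
    , trans (cong (λ k → g ∷ʳ k) closing) (++-assoc qs (r ∷ ps) [ q ])
    , sym (++-assoc ps [ q ] qs)
    , sym (trans (cong (_% n) y+) (m<n⇒m%n≡m x<n))
    where
    r y : ℕ
    g : List ℕ
    r = n ∸ sum (ps ++ q ∷ qs)
    y = x + sum ps + q ∸ n
    g = qs ++ r ∷ ps
    y≡ : y + n ≡ x + sum ps + q
    y≡ = m∸n+n≡m le
    total : sum ps + (q + sum qs) + r ≡ n
    total = trans (cong (_+ r) (sym (sum-++ ps (q ∷ qs)))) (m+[n∸m]≡n s≤n)
    sumg≡ : sum g ≡ sum qs + (r + sum ps)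
    sumg≡ = sum-++ qs (r ∷ ps)
    closing : n ∸ sum g ≡ q
    closing = trans (cong₂ _∸_ (sym (trans (sym (rearrange (sum ps) q (sum qs) r)) total)) sumg≡) (m+n∸m≡n (sum qs + (r + sum ps)) q)
    y+ : y + (sum qs + r) ≡ x
    y+ = +-cancelʳ-≡ n _ _ (begin
      y + (sum qs + r) + n              ≡⟨ shuffle y (sum qs + r) n ⟩
      y + n + (sum qs + r)              ≡⟨ cong (_+ (sum qs + r)) y≡ ⟩
      x + sum ps + q + (sum qs + r)     ≡⟨ regroup x (sum ps) q (sum qs) r ⟩
      x + (sum ps + (q + sum qs) + r)   ≡⟨ cong (x +_) total ⟩
      x + n                             ∎)
      where open ≡-Reasoning
    sumg : y + sum g ≤ N
    sumg = ≤-pred (subst (_< n) (sym (trans (cong (y +_) (trans sumg≡ (sym (+-assoc (sum qs) r (sum ps)))))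
      (trans (sym (+-assoc y (sum qs + r) (sum ps))) (cong (_+ sum ps) y+)))) lt)
    leng : length g ≡ ℓ
    leng = trans (trans (↭.↭-length (↭.++-comm qs (r ∷ ps))) (trans (cong suc (length-++ ps))
      (trans (sym (+-suc (length ps) (length qs))) (sym (length-++ ps))))) len

  -- Equal multisets of points have the same sorted form, and a sorted form has only one valid cut.
  points-determine : ∀ {x d x′ d′} → Valid (x , d) → Valid (x′ , d′) →
    points x d ↭ points x′ d′ → (x , d) ≡ (x′ , d′)
  points-determine v v′ p
    with y , g , _ , le , rot ← sorted-form v | y′ , g′ , _ , le′ , rot′ ← sorted-form v′
    with refl , refl ← sorted-points-injective g g′ (s≤s le) (s≤s le′)
      (↭-trans (↭-sym (rotation-points le rot)) (↭-trans p (rotation-points le′ rot′))) =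
    rotation-unique le v v′ rot rot′

  Represents : List ℕ → Edge → Set
  Represents l e = Valid e × Rotation l e

  represents-total : ∀ {l} → l ∈ boundedSums (suc ℓ) N → ∃ (Represents l)
  represents-total {l} l∈ with ∈-boundedSums⁻ (suc ℓ) N l∈
  represents-total {y ∷ g} l∈ | len , le = rotation-exists (suc-injective len) le

  represents-injective : ∀ {l l′ e} → l ∈ boundedSums (suc ℓ) N → l′ ∈ boundedSums (suc ℓ) N →
    Represents l e → Represents l′ e → l ≡ l′
  represents-injective {y ∷ g} {y′ ∷ g′} l∈ l′∈ (_ , rot) (_ , rot′)
    with _ , le ← ∈-boundedSums⁻ (suc ℓ) N l∈ | _ , le′ ← ∈-boundedSums⁻ (suc ℓ) N l′∈
    with refl , refl ← sorted-points-injective g g′ (s≤s le) (s≤s le′)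
      (↭-trans (↭-sym (rotation-points le rot)) (rotation-points le′ rot′)) = refl

  -- Every valid edge is the only valid cut of some sorted multiset, so the representatives of all
  -- sorted multisets exhaust the edges.
  edges : ∃ λ L → length L ≡ numMultisets n (suc ℓ) × Unique L ×
    (∀ {e} → e ∈ L → Valid e) × (∀ {e} → Valid e → e ∈ L)
  edges with L , len , L! , sound , complete ← representatives Represents (boundedSums (suc ℓ) N)
               (boundedSums-unique (suc ℓ) N) represents-total represents-injective =
    L , trans len (length-boundedSums (suc ℓ) N) , L! , (λ e∈ → proj₁ (proj₂ (proj₂ (sound e∈)))) , complete′
    where
    complete′ : ∀ {e} → Valid e → e ∈ L
    complete′ v with y , g , len , le , rot ← sorted-form v
      with e′ , e′∈ , v′ , rot′ ← complete (∈-boundedSums⁺ (suc ℓ) N (y ∷ g) (cong suc len) le)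
      with refl ← rotation-unique le v v′ rot rot′ = e′∈

  module Enumerated (L : List Edge) (length-L : length L ≡ numMultisets n (suc ℓ)) (L! : Unique L)
    (sound : ∀ {e} → e ∈ L → Valid e) (complete : ∀ {e} → Valid e → e ∈ L) where

    open Euler _≟ₑ_ source σ Valid L complete sound σ-valid σ-injective

    -- Connectivity

    -- The base point is left free, since rotation moves it; the different base points are joined at
    -- the end, by `zeros-connected`.
    _⇝_ : List ℕ → List ℕ → Set
    d ⇝ d′ = ∀ {x} → x < n → ∃ λ x′ → x′ < n × (x , d) ~ (x′ , d′)

    ⇝-trans : ∀ {d d′ d″} → d ⇝ d′ → d′ ⇝ d″ → d ⇝ d″
    ⇝-trans p q x<n with _ , x′<n , r ← p x<n with x″ , x″<n , r′ ← q x′<n = x″ , x″<n , ~-trans r r′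

    rotate : ∀ p q → Word (p ++ q) → ∀ {x} → x < n → (x , p ++ q) ~ ((x + sum p) % n , q ++ p)
    rotate [] q w {x} x<n = subst ((x , q) ~_)
      (cong₂ _,_ (sym (trans (cong (_% n) (+-identityʳ x)) (m<n⇒m%n≡m x<n))) (sym (++-identityʳ q))) ~-refl
    rotate (d ∷ p) q w {x} x<n = ~-trans (step (x<n , w))
      (subst₂ (λ a b → ((x + d) % n , a) ~ b) (sym (++-assoc p q [ d ]))
        (cong₂ _,_ (trans ([m%n+k]%n (x + d) (sum p)) (cong (_% n) (+-assoc x d (sum p)))) (++-assoc q [ d ] p))
        (rotate p (q ∷ʳ d) (word-resp-↭ (↭-trans (↭.∷↭∷ʳ d (p ++ q)) (↭-reflexive (++-assoc p q [ d ]))) w) (m%n<n (x + d) n)))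

    ⇝-rotate : ∀ p q → Word (p ++ q) → (p ++ q) ⇝ (q ++ p)
    ⇝-rotate p q w {x} x<n = (x + sum p) % n , m%n<n (x + sum p) n , rotate p q w x<n

    ~-changeLast : ∀ w {u v} → Word (w ∷ʳ u) → Word (w ∷ʳ v) → ∀ {x} → x < n → (x , w ∷ʳ u) ~ (x , w ∷ʳ v)
    ~-changeLast w {u} {v} a b {x} x<n = join (x<n , a) (x<n , b)
      (cong (x ,_) (trans (dropLast-∷ʳ w u) (sym (dropLast-∷ʳ w v))))

    -- The source of an edge ignores just the last letter, so the letter in question is rotated to
    -- the end, changed there and rotated back.
    ⇝-change : ∀ p {u v} q → Word (p ++ u ∷ q) → Word (p ++ v ∷ q) → (p ++ u ∷ q) ⇝ (p ++ v ∷ q)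
    ⇝-change p {u} {v} q a b = ⇝-trans
      (subst (_⇝ (q ++ p ∷ʳ u)) (++-assoc p [ u ] q) (⇝-rotate (p ∷ʳ u) q (subst Word (sym (++-assoc p [ u ] q)) a)))
      (⇝-trans mid
      (subst ((q ++ p ∷ʳ v) ⇝_) (++-assoc p [ v ] q) (⇝-rotate q (p ∷ʳ v) (cycled b))))
      where
      cycled : ∀ {z} → Word (p ++ z ∷ q) → Word (q ++ p ∷ʳ z)
      cycled {z} = word-resp-↭ (↭-trans (↭-reflexive (sym (++-assoc p [ z ] q))) (↭.++-comm (p ∷ʳ z) q))
      mid : (q ++ p ∷ʳ u) ⇝ (q ++ p ∷ʳ v)
      mid {x} x<n = x , x<n , subst₂ (λ c d → (x , c) ~ (x , d)) (++-assoc q p [ u ]) (++-assoc q p [ v ])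
        (~-changeLast (q ++ p) (subst Word (sym (++-assoc q p [ u ])) (cycled a))
          (subst Word (sym (++-assoc q p [ v ])) (cycled b)) x<n)

    Strict : List ℕ → Set
    Strict d = ∀ {y} → y ∈ d → y + sum d < n

    strict-word : ∀ {d} → length d ≡ ℓ → 0 ∈ d → Strict d → Word d
    strict-word len 0∈ st = len , <⇒≤ (st 0∈) , V-strict 0∈ st

    zeros : ℕ → List ℕ
    zeros k = replicate k 0

    zeros-++ : ∀ i q → zeros i ++ 0 ∷ q ≡ zeros (suc i) ++ q
    zeros-++ zero    q = refl
    zeros-++ (suc i) q = cong (0 ∷_) (zeros-++ i q)

    sum-zeros : ∀ i → sum (zeros i) ≡ 0
    sum-zeros zero    = refl
    sum-zeros (suc i) = sum-zeros i

    -- The omitted difference is larger than every letter and only grows.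
    strict⇝zeros : ∀ i q → suc i + length q ≡ ℓ → Strict (zeros (suc i) ++ q) → (zeros (suc i) ++ q) ⇝ zeros ℓ
    strict⇝zeros i [] len st {x} x<n = x , x<n , subst (λ d → (x , zeros (suc i) ++ []) ~ (x , d))
      (trans (++-identityʳ _) (cong zeros (trans (sym (+-identityʳ (suc i))) len))) ~-refl
    strict⇝zeros i (u ∷ q) len st = ⇝-trans (⇝-change (zeros (suc i)) q (strict-word len₁ (here refl) st)
        (strict-word len₂ (here refl) st′))
      (subst (_⇝ zeros ℓ) (sym (zeros-++ (suc i) q))
        (strict⇝zeros (suc i) q (trans (cong suc (sym (+-suc i (length q)))) len) (subst Strict (zeros-++ (suc i) q) st′)))
      where
      len₁ : length (zeros (suc i) ++ u ∷ q) ≡ ℓ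
      len₁ = trans (length-++ (zeros (suc i))) (trans (cong (_+ suc (length q)) (length-replicate (suc i))) len)
      len₂ : length (zeros (suc i) ++ 0 ∷ q) ≡ ℓ
      len₂ = trans (length-++ (zeros (suc i))) (trans (cong (_+ suc (length q)) (length-replicate (suc i))) len)
      sum≤ : sum (zeros (suc i) ++ 0 ∷ q) ≤ sum (zeros (suc i) ++ u ∷ q)
      sum≤ = subst₂ _≤_ (sym (sum-++ (zeros (suc i)) (0 ∷ q))) (sym (sum-++ (zeros (suc i)) (u ∷ q)))
        (+-monoʳ-≤ (sum (zeros (suc i))) (m≤n+m (sum q) u))
      st′ : Strict (zeros (suc i) ++ 0 ∷ q)
      st′ {y} y∈ with ∈-++⁻ (zeros (suc i)) y∈
      ... | inj₁ p = ≤-<-trans (+-monoʳ-≤ y sum≤) (st (∈-++⁺ˡ p))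
      ... | inj₂ (here refl) = ≤-<-trans sum≤ (st (here refl))
      ... | inj₂ (there p) = ≤-<-trans (+-monoʳ-≤ y sum≤) (st (∈-++⁺ʳ (zeros (suc i)) (there p)))

    -- Replacing a largest letter by 0 makes the omitted difference the strict maximum.
    slack⇝zeros : ∀ {d} → Word d → sum d < n → d ⇝ zeros ℓ
    slack⇝zeros {d₀ ∷ ds} w@(len , _ , _) s<n with c , c∈ , max ← maximum d₀ ds
      with p , q , eq ← ∈-∃++ c∈ = subst (_⇝ zeros ℓ) (sym eq)
        (⇝-trans (⇝-change p q (subst Word eq w) word₀)
        (⇝-trans (⇝-rotate p (0 ∷ q) word₀) (strict⇝zeros 0 (q ++ p) len′ st)))
      where
      sum-d : sum (d₀ ∷ ds) ≡ c + sum (q ++ p)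
      sum-d = trans (cong sum eq) (sum-↭ (↭-trans (↭.++-comm p (c ∷ q)) ↭-refl))
      st : Strict (0 ∷ q ++ p)
      st (here refl) = ≤-<-trans (m≤n+m (sum (q ++ p)) c) (subst (_< n) sum-d s<n)
      st {y} (there y∈) = ≤-<-trans (+-monoˡ-≤ (sum (q ++ p)) (max (subst (y ∈_) (sym eq) (y∈d (∈-++⁻ q y∈)))))
        (subst (_< n) sum-d s<n)
        where
        y∈d : y ∈ q ⊎ y ∈ p → y ∈ p ++ c ∷ q
        y∈d (inj₁ a) = ∈-++⁺ʳ p (there a)
        y∈d (inj₂ a) = ∈-++⁺ˡ a
      len′ : suc (length (q ++ p)) ≡ ℓ
      len′ = trans (sym (↭.↭-length (↭.++-comm p (c ∷ q)))) (trans (sym (cong length eq)) len)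
      word₀ : Word (p ++ 0 ∷ q)
      word₀ = word-resp-↭ (↭.++-comm (0 ∷ q) p) (strict-word len′ (here refl) st)

    -- A word that omits 0 is out of reach of `slack⇝zeros`; `V-tight` first changes one letter so
    -- that the omitted difference becomes positive.
    word⇝zeros : ∀ {d} → Word d → d ⇝ zeros ℓ
    word⇝zeros {d} w@(len , s≤n , vd) with m≤n⇒m<n∨m≡n s≤n
    ... | inj₁ s<n = slack⇝zeros w s<n
    ... | inj₂ s≡n with u , v , ws , d↭ , vw , lt ← V-tight len s≡n vd
      with p , q , refl ← ∈-∃++ (↭.∈-resp-↭ (↭-sym d↭) (here refl)) =
      ⇝-trans (⇝-change p q w w′) (slack⇝zeros w′ (subst (_< n) (sum-↭ v↭) lt))
      where
      v↭ : v ∷ ws ↭ p ++ v ∷ q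
      v↭ = ↭-trans (prep v (↭-sym (↭.drop-∷ (↭-trans (↭-sym (↭.shift u p q)) d↭)))) (↭-sym (↭.shift v p q))
      w′ : Word (p ++ v ∷ q)
      w′ = word-resp-↭ v↭ (trans (↭.↭-length (↭-sym d↭)) len , <⇒≤ lt , vw)

    zeros-word : Word (zeros ℓ)
    zeros-word = strict-word (length-replicate ℓ) (here refl) st
      where
      ∈-zeros : ∀ {y} k → y ∈ zeros k → y ≡ 0
      ∈-zeros (suc k) (here eq) = eq
      ∈-zeros (suc k) (there p) = ∈-zeros k p
      st : Strict (zeros ℓ)
      st {y} y∈ rewrite ∈-zeros ℓ y∈ | sum-zeros ℓ′ = z<s

    -- Rotating 0…01 once around moves the base point by 1.
    zeros-next : ∀ {x} → x < n → (x , zeros ℓ) ~ ((x + 1) % n , zeros ℓ)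
    zeros-next {x} x<n = ~-trans (subst (λ d → (x , d) ~ (x , zs ∷ʳ 1)) zs∷ʳ0 (~-changeLast zs zs0-word one-word x<n))
      (~-trans (rotate zs [ 1 ] one-word x<n)
      (~-trans (step (m%n<n (x + sum zs) n , word-resp-↭ (↭-sym (↭.∷↭∷ʳ 1 zs)) one-word))
      (subst (λ y → (((x + sum zs) % n + 1) % n , zs ∷ʳ 1) ~ (y , zeros ℓ)) base
        (subst (λ d → (((x + sum zs) % n + 1) % n , zs ∷ʳ 1) ~ (((x + sum zs) % n + 1) % n , d)) zs∷ʳ0
          (~-changeLast zs one-word zs0-word (m%n<n ((x + sum zs) % n + 1) n))))))
      where
      zs : List ℕ
      zs = zeros (suc ℓ′)
      zs∷ʳ0 : zs ∷ʳ 0 ≡ zeros ℓ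
      zs∷ʳ0 = trans (zeros-++ (suc ℓ′) []) (++-identityʳ _)
      zs0-word : Word (zs ∷ʳ 0)
      zs0-word = subst Word (sym zs∷ʳ0) zeros-word
      base : ((x + sum zs) % n + 1) % n ≡ (x + 1) % n
      base = trans ([m%n+k]%n (x + sum zs) 1) (cong (λ k → (k + 1) % n) (trans (cong (x +_) (sum-zeros ℓ′)) (+-identityʳ x)))
      sum-one : sum (zs ∷ʳ 1) ≡ 1
      sum-one = trans (sum-∷ʳ zs 1) (cong (_+ 1) (sum-zeros ℓ′))
      ∈-one : ∀ {y} k → y ∈ zeros k ∷ʳ 1 → y ≤ 1
      ∈-one zero    (here refl) = ≤-refl
      ∈-one (suc k) (here refl) = z≤n
      ∈-one (suc k) (there p)   = ∈-one k p
      -- The omitted difference is `n` - 1, which exceeds the letter 1 because `n` is at least 3.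
      one-word : Word (zs ∷ʳ 1)
      one-word = strict-word (trans (length-∷ʳ zs 1) (cong suc (length-replicate (suc ℓ′)))) (here refl)
        λ {y} y∈ → ≤-<-trans (+-mono-≤ (∈-one (suc ℓ′) y∈) (≤-reflexive sum-one)) 3≤n

    zeros-connected : ∀ x → x < n → (0 , zeros ℓ) ~ (x , zeros ℓ)
    zeros-connected zero    _   = ~-refl
    zeros-connected (suc x) x<n = ~-trans (zeros-connected x (<⇒≤ x<n))
      (subst (λ y → (x , zeros ℓ) ~ (y , zeros ℓ)) (trans (cong (_% n) (+-comm x 1)) (m<n⇒m%n≡m x<n)) (zeros-next (<⇒≤ x<n)))

    connected : ∀ {e} → Valid e → (0 , zeros ℓ) ~ e
    connected (x<n , w) with x′ , x′<n , p ← word⇝zeros w x<n = ~-trans (zeros-connected x′ x′<n) (~-sym p)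

    -- Reading the cycle off a circuit

    walk-head : ∀ {u es v} → Walk u es v → ∀ j → toℕ j ≡ 0 → source (lookup es j) ≡ u
    walk-head (e ∷ p) zero refl = refl

    walk-last : ∀ {u es v} → Walk u es v → ∀ i → suc (toℕ i) ≡ length es → source (σ (lookup es i)) ≡ v
    walk-last {es = _ ∷ []} (e ∷ []) zero    eq = refl
    walk-last {es = _ ∷ _}  (e ∷ p)  (suc i) eq = walk-last p i (suc-injective eq)

    walk-next : ∀ {u es v} → Walk u es v → ∀ i j → toℕ j ≡ suc (toℕ i) →
      source (lookup es j) ≡ source (σ (lookup es i))
    walk-next (e ∷ p) zero    (suc j) eq = walk-head p j (suc-injective eq)
    walk-next (e ∷ p) (suc i) (suc j) eq = walk-next p i j (suc-injective eq)

    suc-% : ∀ k m → suc k % suc m ≡ suc (k % suc m) % suc m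
    suc-% k m = trans (cong (_% suc m) (+-comm 1 k))
      (trans (sym (Points.[m%n+k]%n m k 1)) (cong (_% suc m) (+-comm (k % suc m) 1)))

    closed-walk-next : ∀ {u e es} → Walk u (e ∷ es) u → ∀ k →
      source (lookup (e ∷ es) (suc k mod suc (length es))) ≡ source (σ (lookup (e ∷ es) (k mod suc (length es))))
    closed-walk-next {es = es} p k with m≤n⇒m<n∨m≡n (m%n<n k (suc (length es)))
    ... | inj₁ lt = walk-next p (k mod suc (length es)) (suc k mod suc (length es))
      (trans (toℕ-fromℕ< (m%n<n (suc k) (suc (length es)))) (trans (suc-% k (length es))
        (trans (m<n⇒m%n≡m lt) (cong suc (sym (toℕ-fromℕ< (m%n<n k (suc (length es)))))))))
    -- After the last edge the index returns to 0, where the closed walk begins.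
    ... | inj₂ eq = trans
      (walk-head p (suc k mod suc (length es)) (trans (toℕ-fromℕ< (m%n<n (suc k) (suc (length es))))
        (trans (suc-% k (length es)) (trans (cong (_% suc (length es)) eq) (n%n≡0 (suc (length es)))))))
      (sym (walk-last p (k mod suc (length es)) (trans (cong suc (toℕ-fromℕ< (m%n<n k (suc (length es))))) eq)))

    source-inverse : ∀ {e y w} → Valid e → source e ≡ (y , w) → ∃ λ z → proj₁ e ≡ y × proj₂ e ≡ w ∷ʳ z
    source-inverse {x , d} v eq with initLast d
    source-inverse {x , .[]} (_ , () , _) eq | []
    source-inverse {x , .(w ∷ʳ z)} v eq | w ∷ʳ′ z = z , cong proj₁ eq ,
      cong (_∷ʳ z) (trans (sym (dropLast-∷ʳ w z)) (cong proj₂ eq))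

    -- A step along the circuit moves the base point by the first letter, drops that letter and
    -- appends an unknown one, collected in `rest`. So the next base points depend on the word of
    -- `c 0` alone.
    sequence-points : (c : ℕ → Edge) → (∀ j → source (c (suc j)) ≡ source (σ (c j))) →
      (∀ j → Valid (c j)) → ∀ ds rest → proj₂ (c 0) ≡ ds ++ rest →
      applyUpTo (λ j → proj₁ (c j) % n) (suc (length ds)) ≡ points (proj₁ (c 0)) ds
    sequence-points c next valid [] rest eq = refl
    sequence-points c next valid (d ∷ ds) rest eq =
      let z , x≡ , w≡ = source-inverse (valid 1) source₁ in
      cong (proj₁ (c 0) % n ∷_) (trans
        (sequence-points (c ∘ suc) (next ∘ suc) (valid ∘ suc) ds (rest ∷ʳ z) (trans w≡ (++-assoc ds rest [ z ])))
        (points-cong _ _ ds (trans (cong (_% n) x≡) (m%n%n≡m%n (proj₁ (c 0) + d) n))))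
      where
      source₁ : source (c 1) ≡ ((proj₁ (c 0) + d) % n , ds ++ rest)
      source₁ = trans (next 0) (trans (cong (λ w → source (σ (proj₁ (c 0) , w))) eq)
        (cong ((proj₁ (c 0) + d) % n ,_) (dropLast-∷ʳ (ds ++ rest) d)))

    assign : (C : List Edge) → Fin (length C) → Fin n
    assign C i = proj₁ (lookup C i) mod n

    -- This reduces windows to edges: by `points-determine`, windows with equal multisets come from
    -- equal edges, and the circuit repeats none.
    window-points : ∀ C {v} → Walk v C v → (∀ {e} → e ∈ C → Valid e) → ∀ i →
      map toℕ (window (suc ℓ) (assign C) i) ≡ points (proj₁ (lookup C i)) (proj₂ (lookup C i))
    window-points C@(e ∷ es) walk valid i = begin
      map toℕ (map (λ j → assign C (shiftMod K i j)) (upTo (suc ℓ)))  ≡⟨ map-∘ (upTo (suc ℓ)) ⟨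
      map (λ j → toℕ (assign C (shiftMod K i j))) (upTo (suc ℓ))
        ≡⟨ map-cong (λ j → toℕ-fromℕ< (m%n<n (proj₁ (c j)) n)) (upTo (suc ℓ)) ⟩
      map (λ j → proj₁ (c j) % n) (upTo (suc ℓ))                      ≡⟨ map-upTo _ (suc ℓ) ⟩
      applyUpTo (λ j → proj₁ (c j) % n) (suc ℓ)
        ≡⟨ cong (λ k → applyUpTo (λ j → proj₁ (c j) % n) (suc k)) (proj₁ (proj₂ (valid (∈-lookup {xs = C} (shiftMod K i 0))))) ⟨
      applyUpTo (λ j → proj₁ (c j) % n) (suc (length (proj₂ (c 0))))
        ≡⟨ sequence-points c next (λ j → valid (∈-lookup {xs = C} (shiftMod K i j))) (proj₂ (c 0)) [] (sym (++-identityʳ _)) ⟩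
      points (proj₁ (c 0)) (proj₂ (c 0))
        ≡⟨ cong (λ k → points (proj₁ (lookup C k)) (proj₂ (lookup C k))) i+0 ⟩
      points (proj₁ (lookup C i)) (proj₂ (lookup C i)) ∎
      where
      open ≡-Reasoning
      K : ℕ
      K = length C
      c : ℕ → Edge
      c j = lookup C (shiftMod K i j)
      next : ∀ j → source (c (suc j)) ≡ source (σ (c j))
      next j = subst (λ k → source (lookup C (k mod K)) ≡ source (σ (c j))) (sym (+-suc (toℕ i) j))
        (closed-walk-next walk (toℕ i + j))
      i+0 : shiftMod K i 0 ≡ i
      i+0 = toℕ-injective (trans (toℕ-fromℕ< (m%n<n (toℕ i + 0) K))
        (trans (cong (_% K) (+-identityʳ (toℕ i))) (m<n⇒m%n≡m (toℕ<n i))))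

    distinct : ∀ C {v} → Walk v C v → Unique C → (∀ {e} → e ∈ C → Valid e) →
      ∀ i j → i ≢ j → ¬ (window (suc ℓ) (assign C) i ↭ window (suc ℓ) (assign C) j)
    distinct C walk C! valid i j i≢j p = i≢j (lookup-unique C!
      (points-determine (valid (∈-lookup {xs = C} i)) (valid (∈-lookup {xs = C} j))
        (↭-trans (↭-reflexive (sym (window-points C walk valid i)))
          (↭-trans (↭.map⁺ toℕ p) (↭-reflexive (window-points C walk valid j))))))

    mcycle : MCycleExists n (suc ℓ)
    mcycle = let C , v , walk , C! , valid , len = circuit {0 , zeros ℓ} (z<s , zeros-word) connected L! in
      mcycle-of-length (trans len length-L) (assign C , distinct C walk C! valid)

  mcycle-exists : MCycleExists n (suc ℓ)
  mcycle-exists = let L , length-L , L! , sound , complete = edges in Enumerated.mcycle L length-L L! sound complete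

-- Multiplicities and simple elements

indicator : {P : Set} → Dec P → ℕ
indicator (yes _) = 1
indicator (no _)  = 0

indicator-cases : {P : Set} (P? : Dec P) → (P × indicator P? ≡ 1) ⊎ (¬ P × indicator P? ≡ 0)
indicator-cases (yes p) = inj₁ (p , refl)
indicator-cases (no ¬p) = inj₂ (¬p , refl)

δ : ℕ → ℕ → ℕ
δ y x = indicator (y ≟ x)

δ-cases : ∀ y x → (y ≡ x × δ y x ≡ 1) ⊎ (y ≢ x × δ y x ≡ 0)
δ-cases y x = indicator-cases (y ≟ x)

count : ℕ → List ℕ → ℕ
count y []       = 0
count y (x ∷ xs) = δ y x + count y xs

count-here : ∀ y xs → count y (y ∷ xs) ≡ suc (count y xs)
count-here y xs with δ-cases y y
... | inj₁ (_ , eq)  = cong (_+ count y xs) eq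
... | inj₂ (neq , _) = ⊥-elim (neq refl)

count-there : ∀ {y x} xs → y ≢ x → count y (x ∷ xs) ≡ count y xs
count-there {y} {x} xs neq with δ-cases y x
... | inj₁ (eq , _) = ⊥-elim (neq eq)
... | inj₂ (_ , eq) = cong (_+ count y xs) eq

count-↭ : ∀ y {xs ys} → xs ↭ ys → count y xs ≡ count y ys
count-↭ y Perm.refl             = refl
count-↭ y (Perm.prep x p)       = cong (δ y x +_) (count-↭ y p)
count-↭ y (Perm.swap {ys = ys} x z p) = trans (cong (λ k → δ y x + (δ y z + k)) (count-↭ y p))
  (exchange (δ y x) (δ y z) (count y ys))
  where
  exchange : ∀ a b c → a + (b + c) ≡ b + (a + c)
  exchange = solve 3 (λ a b c → a :+ (b :+ c) := b :+ (a :+ c)) refl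
count-↭ y (Perm.trans p q)      = trans (count-↭ y p) (count-↭ y q)

∉⇒count≡0 : ∀ y xs → y ∉ xs → count y xs ≡ 0
∉⇒count≡0 y []       y∉ = refl
∉⇒count≡0 y (x ∷ xs) y∉ = trans (count-there xs (y∉ ∘ here)) (∉⇒count≡0 y xs (y∉ ∘ there))

∈⇒count≢0 : ∀ {y xs} → y ∈ xs → count y xs ≢ 0
∈⇒count≢0 {y} {xs = x ∷ xs} (here refl) eq with () ← trans (sym (count-here y xs)) eq
∈⇒count≢0 {y} {xs = x ∷ xs} (there p)     eq = ∈⇒count≢0 p (m+n≡0⇒n≡0 (δ y x) eq)

count≡1⇒∈ : ∀ {y} xs → count y xs ≡ 1 → y ∈ xs
count≡1⇒∈ {y} (x ∷ xs) eq with δ-cases y x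
... | inj₁ (refl , _) = here refl
... | inj₂ (neq , _) = there (count≡1⇒∈ xs (trans (sym (count-there xs neq)) eq))

∈⇒≤sum : ∀ {y xs} → y ∈ xs → y ≤ sum xs
∈⇒≤sum {xs = x ∷ xs} (here refl) = m≤m+n x (sum xs)
∈⇒≤sum {xs = x ∷ xs} (there p)     = ≤-trans (∈⇒≤sum p) (m≤n+m (sum xs) x)

NoUnique : List ℕ → Set
NoUnique M = ∀ y → count y M ≢ 1

largest-below : ∀ M m → (∀ y → m ≤ y → count y M ≢ 1) → ¬ NoUnique M →
  ∃ λ r → count r M ≡ 1 × (∀ y → r < y → count y M ≢ 1)
largest-below M zero    none some = ⊥-elim (some (λ y → none y z≤n))
largest-below M (suc m) none some with count m M ≟ 1
... | yes eq = m , eq , none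
... | no neq = largest-below M m none′ some
  where
  none′ : ∀ y → m ≤ y → count y M ≢ 1
  none′ y m≤y with m≤n⇒m<n∨m≡n m≤y
  ... | inj₁ m<y     = none y m<y
  ... | inj₂ refl = neq

largest-unique : ∀ M → ¬ NoUnique M → ∃ λ r → count r M ≡ 1 × (∀ y → r < y → count y M ≢ 1)
-- No element exceeds `sum M`, so the downward search may start just above it.
largest-unique M = largest-below M (suc (sum M)) λ y sum<y eq → <⇒≱ sum<y (∈⇒≤sum (count≡1⇒∈ M eq))

-- Multisets without a simple element; (j , a) stands for 2 + j copies of a

expand : List (ℕ × ℕ) → List ℕ
expand []             = []
expand ((j , a) ∷ bs) = replicate (2 + j) a ++ expand bs

extract : ∀ x M → ∃ λ M′ → M ↭ replicate (count x M) x ++ M′ × count x M′ ≡ 0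
extract x [] = [] , ↭-refl , refl
extract x (y ∷ M) with M′ , p , c ← extract x M with δ-cases x y
... | inj₁ (refl , _) = M′ , ↭-trans (prep x p) (↭-reflexive (cong (λ k → replicate k x ++ M′) (sym (count-here x M)))) , c
... | inj₂ (neq , _) = y ∷ M′ , ↭-trans (prep y p) (↭-trans (↭-sym (↭.shift y (replicate (count x M) x) M′))
    (↭-reflexive (cong (λ k → replicate k x ++ y ∷ M′) (sym (count-there M neq))))) ,
  trans (count-there M′ neq) c

count-replicate-++ : ∀ {y x} k xs → y ≢ x → count y (replicate k x ++ xs) ≡ count y xs
count-replicate-++ zero    xs neq = refl
count-replicate-++ {x = x} (suc k) xs neq = trans (count-there (replicate k x ++ xs) neq) (count-replicate-++ k xs neq)

-- All copies of the first element, at least two, are removed at once; the rest still has no simple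
-- element. `k` bounds the length for the recursion.
noUnique⇒expand : ∀ k M → length M ≤ k → NoUnique M → ∃ λ bs → M ↭ expand bs
noUnique⇒expand k [] le none = [] , ↭-refl
noUnique⇒expand (suc k) (x ∷ M) (s≤s le) none with M′ , p , c ← extract x (x ∷ M)
  with count x (x ∷ M) in eq | none x
... | zero        | _  = ⊥-elim (∈⇒count≢0 {x} {x ∷ M} (here refl) eq)
... | suc zero    | ≢1 = ⊥-elim (≢1 refl)
... | suc (suc j) | _  = let bs , q = noUnique⇒expand k M′ len none′ in
  (j , x) ∷ bs , ↭-trans p (↭.++⁺ˡ (replicate (2 + j) x) q)
  where
  len : length M′ ≤ k
  len = ≤-trans (≤-trans (m≤n+m (length M′) (suc (length (replicate j x))))
    (≤-reflexive (trans (cong suc (sym (length-++ (replicate j x)))) (suc-injective (sym (↭.↭-length p)))))) le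
  none′ : NoUnique M′
  none′ y eq₁ with δ-cases y x
  ... | inj₁ (refl , _) with () ← trans (sym c) eq₁
  ... | inj₂ (neq , _) = none y (trans (count-↭ y p) (trans (count-replicate-++ (2 + j) M′ neq) eq₁))

-- The omitted difference is the largest simple one, except that β is omitted
-- whenever it is simple and no difference vanishes. Without this exception the
-- words b b (t = 3, n = 2b) and 1 1 1 b b (t = 6, n = 2b + 3) would be isolated;
-- β = b − 1 joins them to b 1 and 1 1 1 1 b.

Exceptional : ℕ → List ℕ → Set
Exceptional β M = count 0 M ≡ 0 × count β M ≡ 1

Omits : ℕ → ℕ → List ℕ → Set
Omits β r d = count r d ≡ 0 × ((count 0 (r ∷ d) ≡ 0 × r ≡ β)
  ⊎ (¬ Exceptional β (r ∷ d) × (∀ y → r < y → count y d ≢ 1)))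

omits-resp-↭ : ∀ {β r d d′} → d ↭ d′ → Omits β r d → Omits β r d′
omits-resp-↭ {β} {r} p (fresh , inj₁ (c₀ , r≡β)) =
  trans (sym (count-↭ r p)) fresh , inj₁ (trans (sym (count-↭ 0 (prep r p))) c₀ , r≡β)
omits-resp-↭ {β} {r} p (fresh , inj₂ (¬ex , max)) = trans (sym (count-↭ r p)) fresh ,
  inj₂ ((λ { (c₀ , c₁) → ¬ex (trans (count-↭ 0 (prep r p)) c₀ , trans (count-↭ β (prep r p)) c₁) }) ,
    λ y r<y c → max y r<y (trans (count-↭ y p) c))

omits-exists : ∀ β M → ¬ NoUnique M → ∃₂ λ r d → M ↭ r ∷ d × Omits β r d
omits-exists β M some with (count 0 M ≟ 0) ×-dec (count β M ≟ 1)
... | yes (c₀ , c₁) with d , p ← ∈⇒↭∷ (count≡1⇒∈ M c₁) = β , d , p ,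
  suc-injective (trans (sym (count-here β d)) (trans (sym (count-↭ β p)) c₁)) ,
  inj₁ (trans (sym (count-↭ 0 p)) c₀ , refl)
... | no ¬ex with r , c₁ , max ← largest-unique M some with d , p ← ∈⇒↭∷ (count≡1⇒∈ M c₁) = r , d , p ,
  suc-injective (trans (sym (count-here r d)) (trans (sym (count-↭ r p)) c₁)) ,
  inj₂ ((λ { (a , b) → ¬ex (trans (count-↭ 0 p) a , trans (count-↭ β p) b) }) ,
    λ y r<y c → max y r<y (trans (count-↭ y p) (trans (count-there d (≢-sym (<⇒≢ r<y))) c)))

-- Whether the exception applies depends only on the whole multiset, so both choices follow the same
-- clause; two largest simple elements coincide.
omits-unique : ∀ {β r r′ d d′} → r ∷ d ↭ r′ ∷ d′ → Omits β r d → Omits β r′ d′ → r ≡ r′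
omits-unique p (_ , inj₁ (_ , refl)) (_ , inj₁ (_ , refl)) = refl
omits-unique {β} {d = d} p (f , inj₁ (c₀ , refl)) (_ , inj₂ (¬ex , _)) =
  ⊥-elim (¬ex (trans (sym (count-↭ 0 p)) c₀ , trans (sym (count-↭ β p)) (trans (count-here β d) (cong suc f))))
omits-unique {β} {d′ = d′} p (_ , inj₂ (¬ex , _)) (f , inj₁ (c₀ , refl)) =
  ⊥-elim (¬ex (trans (count-↭ 0 p) c₀ , trans (count-↭ β p) (trans (count-here β d′) (cong suc f))))
omits-unique {r = r} {r′} {d} {d′} p (f , inj₂ (_ , max)) (f′ , inj₂ (_ , max′)) with <-cmp r r′
... | tri≈ _ eq _ = eq
... | tri< lt _ _ = ⊥-elim (max r′ lt (trans (sym (count-there d (≢-sym (<⇒≢ lt))))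
  (trans (count-↭ r′ p) (trans (count-here r′ d′) (cong suc f′)))))
... | tri> _ _ gt = ⊥-elim (max′ r gt (trans (sym (count-there d′ (≢-sym (<⇒≢ gt))))
  (trans (sym (count-↭ r p)) (trans (count-here r d) (cong suc f)))))

-- One letter of d can be changed so that the omitted difference, 0 before, becomes suc r.
Loosens : ℕ → ℕ → List ℕ → Set
Loosens β n d = ∃₂ λ u v → ∃₂ λ w r → d ↭ u ∷ w × suc r + (v + sum w) ≡ n × Omits β (suc r) (v ∷ w)

-- The first condition on `expand` makes the rule applicable to every multiset of differences. The
-- second concerns the words that omit 0: they consist of repeated letters and need an individual
-- repair.
mcycle-by-omission : ∀ N ℓ′ β → 3 ≤ suc N →
  (∀ bs → length (expand bs) ≡ 3 + ℓ′ → sum (expand bs) ≢ suc N) →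
  (∀ bs → length (expand bs) ≡ 2 + ℓ′ → sum (expand bs) ≡ suc N → 0 ∉ expand bs → Loosens β (suc N) (expand bs)) →
  MCycleExists (suc N) (3 + ℓ′)
mcycle-by-omission N ℓ′ β 3≤n simple loosen = Construction.mcycle-exists N ℓ′ 3≤n V resp exists fresh unique strict tight
  where
  n : ℕ
  n = suc N
  V : List ℕ → Set
  V d = Omits β (n ∸ sum d) d
  omitted : ∀ {r} d → r + sum d ≡ n → n ∸ sum d ≡ r
  omitted {r} d eq = trans (cong (_∸ sum d) (sym eq)) (m+n∸n≡m r (sum d))
  resp : ∀ {d d′} → d ↭ d′ → V d → V d′
  resp {d} {d′} p v = subst (λ s → Omits β (n ∸ s) d′) (sum-↭ p) (omits-resp-↭ p v)
  exists : ∀ M → length M ≡ 3 + ℓ′ → sum M ≡ n → ∃₂ λ r d → M ↭ r ∷ d × V d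
  exists M len s = let r , d , p , o = omits-exists β M some in
    r , d , p , subst (λ k → Omits β k d) (sym (omitted d (trans (sym (sum-↭ p)) s))) o
    where
    some : ¬ NoUnique M
    some none with bs , p ← noUnique⇒expand (length M) M ≤-refl none =
      simple bs (trans (sym (↭.↭-length p)) len) (trans (sym (sum-↭ p)) s)
  fresh : ∀ {r d} → r + sum d ≡ n → V d → r ∉ d
  fresh {r} {d} eq (f , _) r∈ = ∈⇒count≢0 r∈ (subst (λ k → count k d ≡ 0) (omitted d eq) f)
  unique : ∀ {r r′ d d′} → r ∷ d ↭ r′ ∷ d′ → r + sum d ≡ n → V d → V d′ → r ≡ r′
  unique {r} {r′} {d} {d′} p eq v v′ = omits-unique p (subst (λ k → Omits β k d) (omitted d eq) v)
    (subst (λ k → Omits β k d′) (omitted d′ (trans (sym (sum-↭ p)) eq)) v′)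
  strict : ∀ {d} → 0 ∈ d → (∀ {y} → y ∈ d → y + sum d < n) → V d
  strict {d} 0∈ st = ∉⇒count≡0 (n ∸ sum d) d (λ r∈ → <-irrefl refl (below r∈)) ,
    inj₂ ((λ { (c₀ , _) → ∈⇒count≢0 {xs = (n ∸ sum d) ∷ d} (there 0∈) c₀ }) ,
      λ y r<y c → <-asym r<y (below (count≡1⇒∈ d c)))
    where
    below : ∀ {y} → y ∈ d → y < n ∸ sum d
    below {y} y∈ = m+n≤o⇒m≤o∸n (suc y) (st y∈)
  -- Omitting 0 means that no positive letter is simple, and 0 itself does not occur in `d`.
  noUnique : ∀ d → Omits β 0 d → NoUnique d
  noUnique d (f , inj₁ (c₀ , _))  with () ← trans (sym (count-here 0 d)) c₀
  noUnique d (f , inj₂ (_ , max)) zero    c with () ← trans (sym f) c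
  noUnique d (f , inj₂ (_ , max)) (suc y) c = max (suc y) z<s c
  tight : ∀ {d} → length d ≡ 2 + ℓ′ → sum d ≡ n → V d → ∃₂ λ u v → ∃ λ w → d ↭ u ∷ w × V (v ∷ w) × v + sum w < n
  tight {d} len s vd =
    let o₀ = subst (λ k → Omits β k d) (omitted {0} d s) vd
        bs , p = noUnique⇒expand (length d) d ≤-refl (noUnique d o₀)
        u , v , w , r , q , eq , o = loosen bs (trans (sym (↭.↭-length p)) len) (trans (sym (sum-↭ p)) s)
          (λ 0∈ → ∈⇒count≢0 (↭.∈-resp-↭ (↭-sym p) 0∈) (proj₁ o₀))
    in u , v , w , ↭-trans p q , subst (λ k → Omits β k (v ∷ w)) (sym (omitted {suc r} (v ∷ w) eq)) o
      , subst (v + sum w <_) eq (s≤s (m≤n+m (v + sum w) r))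

-- Existence of a simple difference, from coprimality

common-divisor : ∀ {n t} k → gcd n t ≡ 1 → (2 + k) ∣ t → ¬ (2 + k) ∣ n
common-divisor k g ∣t ∣n with () ← ∣1⇒≡1 (subst ((2 + k) ∣_) g (gcd-greatest ∣n ∣t))

pair-count≢1 : ∀ y a → count y (a ∷ a ∷ []) ≢ 1
pair-count≢1 y a with δ-cases y a
... | inj₁ (_ , eq) rewrite eq = λ ()
... | inj₂ (_ , eq) rewrite eq = λ ()

pairs-count≢1 : ∀ y a b → count y (a ∷ a ∷ b ∷ b ∷ []) ≢ 1
pairs-count≢1 y a b with δ-cases y a | δ-cases y b
... | inj₁ (_ , eq) | inj₁ (_ , eq′) rewrite eq | eq′ = λ ()
... | inj₁ (_ , eq) | inj₂ (_ , eq′) rewrite eq | eq′ = λ ()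
... | inj₂ (_ , eq) | inj₁ (_ , eq′) rewrite eq | eq′ = λ ()
... | inj₂ (_ , eq) | inj₂ (_ , eq′) rewrite eq | eq′ = λ ()

full-house-count≢1 : ∀ y a b → count y (b ∷ a ∷ a ∷ b ∷ b ∷ []) ≢ 1
full-house-count≢1 y a b with δ-cases y a | δ-cases y b
... | inj₁ (_ , eq) | inj₁ (_ , eq′) rewrite eq | eq′ = λ ()
... | inj₁ (_ , eq) | inj₂ (_ , eq′) rewrite eq | eq′ = λ ()
... | inj₂ (_ , eq) | inj₁ (_ , eq′) rewrite eq | eq′ = λ ()
... | inj₂ (_ , eq) | inj₂ (_ , eq′) rewrite eq | eq′ = λ ()

-- The only block of size at least 2 that fills 3 places is 3 itself, and then 3 divides `n`.
simple₃ : ∀ {n} → gcd n 3 ≡ 1 → ∀ bs → length (expand bs) ≡ 3 → sum (expand bs) ≢ n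
simple₃ g ((0 , a) ∷ []) ()
simple₃ g ((0 , a) ∷ (_ , b) ∷ bs) ()
simple₃ g ((1 , a) ∷ []) _ refl = common-divisor 1 g (divides 1 refl)
  (divides a (solve 1 (λ a → a :+ (a :+ (a :+ con 0)) := a :* con 3) refl a))
simple₃ g ((1 , a) ∷ (_ , b) ∷ bs) ()
simple₃ g ((suc (suc j) , a) ∷ bs) ()

-- The block sizes 4 and 2 + 2 are even, which would make `n` even.
simple₄ : ∀ {n} → gcd n 4 ≡ 1 → ∀ bs → length (expand bs) ≡ 4 → sum (expand bs) ≢ n
simple₄ g ((0 , a) ∷ []) ()
simple₄ g ((0 , a) ∷ (0 , b) ∷ []) _ refl =
  common-divisor 0 g (divides 2 refl)
  (divides (a + b) (solve 2 (λ a b → a :+ (a :+ (b :+ (b :+ con 0))) := (a :+ b) :* con 2) refl a b))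
simple₄ g ((0 , a) ∷ (0 , b) ∷ (_ , c) ∷ bs) ()
simple₄ g ((0 , a) ∷ (suc j , b) ∷ bs) ()
simple₄ g ((1 , a) ∷ []) ()
simple₄ g ((1 , a) ∷ (_ , b) ∷ bs) ()
simple₄ g ((2 , a) ∷ []) _ refl = common-divisor 0 g (divides 2 refl)
  (divides (2 * a) (solve 1 (λ a → a :+ (a :+ (a :+ (a :+ con 0))) := (con 2 :* a) :* con 2) refl a))
simple₄ g ((2 , a) ∷ (_ , b) ∷ bs) ()
simple₄ g ((suc (suc (suc j)) , a) ∷ bs) ()

-- The possible block sizes are 6, 4 + 2 and 2 + 2 + 2, all even, and 3 + 3, so `n` would be
-- divisible by 2 or by 3.
simple₆ : ∀ {n} → gcd n 6 ≡ 1 → ∀ bs → length (expand bs) ≡ 6 → sum (expand bs) ≢ n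
simple₆ g ((0 , a) ∷ []) ()
simple₆ g ((0 , a) ∷ (0 , b) ∷ []) ()
simple₆ g ((0 , a) ∷ (0 , b) ∷ (0 , c) ∷ []) _ refl =
  common-divisor 0 g (divides 3 refl)
  (divides (a + b + c) (solve 3 (λ a b c → a :+ (a :+ (b :+ (b :+ (c :+ (c :+ con 0))))) := (a :+ b :+ c) :* con 2) refl a b c))
simple₆ g ((0 , a) ∷ (0 , b) ∷ (0 , c) ∷ (_ , d) ∷ bs) ()
simple₆ g ((0 , a) ∷ (0 , b) ∷ (suc j , c) ∷ bs) ()
simple₆ g ((0 , a) ∷ (1 , b) ∷ []) ()
simple₆ g ((0 , a) ∷ (1 , b) ∷ (_ , c) ∷ bs) ()
simple₆ g ((0 , a) ∷ (2 , b) ∷ []) _ refl =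
  common-divisor 0 g (divides 3 refl)
  (divides (a + 2 * b) (solve 2 (λ a b → a :+ (a :+ (b :+ (b :+ (b :+ (b :+ con 0))))) := (a :+ con 2 :* b) :* con 2) refl a b))
simple₆ g ((0 , a) ∷ (2 , b) ∷ (_ , c) ∷ bs) ()
simple₆ g ((0 , a) ∷ (suc (suc (suc j)) , b) ∷ bs) ()
simple₆ g ((1 , a) ∷ []) ()
simple₆ g ((1 , a) ∷ (0 , b) ∷ []) ()
simple₆ g ((1 , a) ∷ (0 , b) ∷ (_ , c) ∷ bs) ()
simple₆ g ((1 , a) ∷ (1 , b) ∷ []) _ refl =
  common-divisor 1 g (divides 2 refl)
  (divides (a + b) (solve 2 (λ a b → a :+ (a :+ (a :+ (b :+ (b :+ (b :+ con 0))))) := (a :+ b) :* con 3) refl a b))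
simple₆ g ((1 , a) ∷ (1 , b) ∷ (_ , c) ∷ bs) ()
simple₆ g ((1 , a) ∷ (suc (suc j) , b) ∷ bs) ()
simple₆ g ((2 , a) ∷ []) ()
simple₆ g ((2 , a) ∷ (0 , b) ∷ []) _ refl =
  common-divisor 0 g (divides 3 refl)
  (divides (2 * a + b) (solve 2 (λ a b → a :+ (a :+ (a :+ (a :+ (b :+ (b :+ con 0))))) := (con 2 :* a :+ b) :* con 2) refl a b))
simple₆ g ((2 , a) ∷ (0 , b) ∷ (_ , c) ∷ bs) ()
simple₆ g ((2 , a) ∷ (suc j , b) ∷ bs) ()
simple₆ g ((3 , a) ∷ []) ()
simple₆ g ((3 , a) ∷ (_ , b) ∷ bs) ()
simple₆ g ((4 , a) ∷ []) _ refl = common-divisor 0 g (divides 3 refl)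
  (divides (3 * a) (solve 1 (λ a → a :+ (a :+ (a :+ (a :+ (a :+ (a :+ con 0))))) := (con 3 :* a) :* con 2) refl a))
simple₆ g ((4 , a) ∷ (_ , b) ∷ bs) ()
simple₆ g ((suc (suc (suc (suc (suc j)))) , a) ∷ bs) ()

-- Repairing the words that omit 0

omits-exception : ∀ {r} d → 0 < r → 0 ∉ d → r ∉ d → Omits r r d
omits-exception {r} d 0<r 0∉ r∉ =
  ∉⇒count≡0 r d r∉ , inj₁ (trans (count-there d (<⇒≢ 0<r)) (∉⇒count≡0 0 d 0∉) , refl)

omits-repeated : ∀ {β r} d → NoUnique d → r ∉ d → β ≢ r → Omits β r d
omits-repeated {β} {r} d none r∉ β≢r = ∉⇒count≡0 r d r∉ ,
  inj₂ ((λ { (_ , c) → none β (trans (sym (count-there d β≢r)) c) }) , λ y _ → none y)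

-- The new letter 1 may be simple, but it lies below `r` and does not compete with it.
omits-repeated-∷1 : ∀ {β r} d → NoUnique d → r ∉ d → 1 < r → β ≢ r → β ≢ 1 → Omits β r (1 ∷ d)
omits-repeated-∷1 {β} {r} d none r∉ 1<r β≢r β≢1 =
  ∉⇒count≡0 r (1 ∷ d) (λ { (here eq) → <⇒≢ 1<r (sym eq) ; (there p) → r∉ p }) ,
  inj₂ ((λ { (_ , c) → none β (trans (sym (trans (count-there (1 ∷ d) β≢r) (count-there d β≢1))) c) }) ,
    λ y r<y c → none y (trans (sym (count-there d (≢-sym (<⇒≢ (<-trans 1<r r<y))))) c))

loosens-resp-↭ : ∀ {β n d d′} → d ↭ d′ → Loosens β n d′ → Loosens β n d
loosens-resp-↭ p (u , v , w , r , q , eq , o) = u , v , w , r , ↭-trans p q , eq , o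

-- The word is a a with n = 2a. It becomes 1 a and omits a - 1, the exceptional value; for a at
-- least 3 this differs from the letter 1.
loosen₃ : ∀ {n} → 5 ≤ n → ∀ bs → length (expand bs) ≡ 2 → sum (expand bs) ≡ n →
  Loosens (pred ⌊ n /2⌋) n (expand bs)
loosen₃ 5≤n ((0 , 0) ∷ []) _ refl with () ← 5≤n
loosen₃ 5≤n ((0 , 1) ∷ []) _ refl with s≤s (s≤s ()) ← 5≤n
loosen₃ 5≤n ((0 , 2) ∷ []) _ refl with s≤s (s≤s (s≤s (s≤s ()))) ← 5≤n
loosen₃ 5≤n ((0 , suc (suc (suc k))) ∷ []) _ refl =
  3 + k , 1 , (3 + k) ∷ [] , suc k , ↭-refl , total k , subst (λ β → Omits β (2 + k) (1 ∷ (3 + k) ∷ [])) half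
    (omits-exception (1 ∷ (3 + k) ∷ []) z<s (λ { (here ()) ; (there (here ())) })
      (λ { (there (here eq)) → 1+n≢n (sym eq) }))
  where
  total : ∀ k → 2 + k + (1 + (3 + k + 0)) ≡ 3 + k + (3 + k + 0)
  total = solve 1 (λ k → con 2 :+ k :+ (con 1 :+ (con 3 :+ k :+ con 0)) := con 3 :+ k :+ (con 3 :+ k :+ con 0)) refl
  half : 2 + k ≡ pred ⌊ 3 + k + (3 + k + 0) /2⌋
  half = cong pred (trans (n≡⌊n+n/2⌋ (3 + k)) (cong (λ m → ⌊ 3 + k + m /2⌋) (sym (+-identityʳ (3 + k)))))
loosen₃ 5≤n ((0 , a) ∷ (_ , b) ∷ bs) ()
loosen₃ 5≤n ((suc j , a) ∷ bs) ()

-- The exceptional value n + 1 is too large to be a difference, so the exception never occurs. The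
-- word a a a becomes 1 a a and omits a - 1, its largest simple difference.
loosen₄ : ∀ {n} → 5 ≤ n → gcd n 4 ≡ 1 → ∀ bs → length (expand bs) ≡ 3 → sum (expand bs) ≡ n →
  Loosens (suc n) n (expand bs)
loosen₄ 5≤n g ((0 , a) ∷ []) ()
loosen₄ 5≤n g ((0 , a) ∷ (_ , b) ∷ bs) ()
loosen₄ 5≤n g ((1 , 0) ∷ []) _ refl with () ← 5≤n
loosen₄ 5≤n g ((1 , 1) ∷ []) _ refl with s≤s (s≤s (s≤s ())) ← 5≤n
-- Here n = 6, which is not coprime to 4.
loosen₄ 5≤n g ((1 , 2) ∷ []) _ refl with () ← g
loosen₄ 5≤n g ((1 , suc (suc (suc k))) ∷ []) _ refl =
  3 + k , 1 , (3 + k) ∷ (3 + k) ∷ [] , suc k , ↭-refl , total k ,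
  omits-repeated-∷1 ((3 + k) ∷ (3 + k) ∷ []) (λ y → pair-count≢1 y (3 + k))
    (λ { (here eq) → 1+n≢n (sym eq) ; (there (here eq)) → 1+n≢n (sym eq) })
    (s≤s z<s) (λ eq → m≢1+m+n (2 + k) (sym (trans (cong suc (total k)) eq))) (λ ())
  where
  total : ∀ k → 2 + k + (1 + (3 + k + (3 + k + 0))) ≡ 3 + k + (3 + k + (3 + k + 0))
  total = solve 1 (λ k → con 2 :+ k :+ (con 1 :+ (con 3 :+ k :+ (con 3 :+ k :+ con 0)))
    := con 3 :+ k :+ (con 3 :+ k :+ (con 3 :+ k :+ con 0))) refl
loosen₄ 5≤n g ((1 , a) ∷ (_ , b) ∷ bs) ()
loosen₄ 5≤n g ((suc (suc j) , a) ∷ bs) ()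

-- In the case t = 6 the exceptional value satisfies 2β + 5 = n.

quintuple-loosens : ∀ {β} a → 3 ≤ β → β + β + 5 ≡ a + (a + (a + (a + (a + 0)))) →
  Loosens β (β + β + 5) (a ∷ a ∷ a ∷ a ∷ a ∷ [])
-- The word becomes 1 a a a a and omits a - 1. This is not β, since 2(a - 1) + 5 < 5a.
quintuple-loosens {β} (suc (suc (suc k))) 3≤β eq =
  3 + k , 1 , (3 + k) ∷ (3 + k) ∷ (3 + k) ∷ (3 + k) ∷ [] , suc k , ↭-refl , trans (total k) (sym eq) ,
  omits-repeated-∷1 ((3 + k) ∷ (3 + k) ∷ (3 + k) ∷ (3 + k) ∷ []) (λ y → pairs-count≢1 y (3 + k) (3 + k))
    (λ { (here eq) → 1+n≢n (sym eq) ; (there (here eq)) → 1+n≢n (sym eq)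
       ; (there (there (here eq))) → 1+n≢n (sym eq) ; (there (there (there (here eq)))) → 1+n≢n (sym eq) })
    (s≤s z<s) (λ { refl → m≢1+m+n (2 + k + (2 + k) + 5) (trans eq (excess k)) })
    (λ { refl → <⇒≱ (s≤s z<s) 3≤β })
  where
  total : ∀ k → 2 + k + (1 + (3 + k + (3 + k + (3 + k + (3 + k + 0))))) ≡ 3 + k + (3 + k + (3 + k + (3 + k + (3 + k + 0))))
  total = solve 1 (λ k → con 2 :+ k :+ (con 1 :+ (con 3 :+ k :+ (con 3 :+ k :+ (con 3 :+ k :+ (con 3 :+ k :+ con 0)))))
    := con 3 :+ k :+ (con 3 :+ k :+ (con 3 :+ k :+ (con 3 :+ k :+ (con 3 :+ k :+ con 0))))) refl
  excess : ∀ k → 3 + k + (3 + k + (3 + k + (3 + k + (3 + k + 0)))) ≡ suc (2 + k + (2 + k) + 5 + (5 + 3 * k))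
  excess = solve 1 (λ k → con 3 :+ k :+ (con 3 :+ k :+ (con 3 :+ k :+ (con 3 :+ k :+ (con 3 :+ k :+ con 0))))
    := con 1 :+ (con 2 :+ k :+ (con 2 :+ k) :+ con 5 :+ (con 5 :+ con 3 :* k))) refl
-- For a at most 2 the sum 5a is below 11, hence too small for 2β + 5.
quintuple-loosens {β} 0 _ eq with () ← trans (+-comm 5 (β + β)) eq
quintuple-loosens {β} 1 3≤β eq with refl ← m+n≡0⇒m≡0 β (+-cancelʳ-≡ 5 (β + β) 0 eq) with () ← 3≤β
quintuple-loosens {β} 2 3≤β eq = ⊥-elim (<⇒≱ {5} {6} ≤-refl (subst (6 ≤_) (+-cancelʳ-≡ 5 (β + β) 5 eq) (+-mono-≤ 3≤β 3≤β)))

+-self-injective : ∀ {m n} → m + m ≡ n + n → m ≡ n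
+-self-injective {m} {n} eq = trans (n≡⌊n+n/2⌋ m) (trans (cong ⌊_/2⌋ eq) (sym (n≡⌊n+n/2⌋ n)))

-- The repair for t = 6 that needs the exception: 1 1 1 b b becomes 1 1 1 1 b and omits b - 1,
-- although b is a larger simple difference.
triple-one-loosens : ∀ β → 2 ≤ β → Loosens (suc β) (suc β + suc β + 5) (1 ∷ 1 ∷ 1 ∷ 2 + β ∷ 2 + β ∷ [])
triple-one-loosens β 2≤β =
  2 + β , 1 , 1 ∷ 1 ∷ 1 ∷ 2 + β ∷ [] , β , ↭.++-comm (1 ∷ 1 ∷ 1 ∷ 2 + β ∷ []) (2 + β ∷ []) , total β ,
  omits-exception (1 ∷ 1 ∷ 1 ∷ 1 ∷ 2 + β ∷ []) z<s
    (λ { (here ()) ; (there (here ())) ; (there (there (here ()))) ; (there (there (there (here ()))))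
       ; (there (there (there (there (here ()))))) })
    (λ { (here eq) → ≢1 eq ; (there (here eq)) → ≢1 eq ; (there (there (here eq))) → ≢1 eq
       ; (there (there (there (here eq)))) → ≢1 eq
       ; (there (there (there (there (here eq))))) → 1+n≢n (sym eq) })
  where
  ≢1 : suc β ≢ 1
  ≢1 = ≢-sym (<⇒≢ (s≤s (≤-trans z<s 2≤β)))
  total : ∀ β → suc β + (1 + (1 + (1 + (1 + (2 + β + 0))))) ≡ suc β + suc β + 5
  total = solve 1 (λ β → con 1 :+ β :+ (con 1 :+ (con 1 :+ (con 1 :+ (con 1 :+ (con 2 :+ β :+ con 0)))))
    := con 1 :+ β :+ (con 1 :+ β) :+ con 5) refl

triple-pair-loosens : ∀ {β} a b → 3 ≤ β → ¬ 2 ∣ β + β + 5 → 0 < a → 0 < b →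
  β + β + 5 ≡ a + (a + (a + (b + (b + 0)))) → Loosens β (β + β + 5) (a ∷ a ∷ a ∷ b ∷ b ∷ [])
triple-pair-loosens {suc β} 1 b (s≤s 2≤β) odd _ _ eq =
  subst (λ b → Loosens (suc β) (suc β + suc β + 5) (1 ∷ 1 ∷ 1 ∷ b ∷ b ∷ [])) (sym b≡) (triple-one-loosens β 2≤β)
  where
  split : ∀ β → suc β + suc β + 5 ≡ 3 + (2 + β + (2 + β))
  split = solve 1 (λ β → con 1 :+ β :+ (con 1 :+ β) :+ con 5 := con 3 :+ (con 2 :+ β :+ (con 2 :+ β))) refl
  b≡ : b ≡ 2 + β
  b≡ = +-self-injective (trans (cong (b +_) (sym (+-identityʳ b))) (+-cancelˡ-≡ 3 _ _ (trans (sym eq) (split β))))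
-- a = 2 would make n even.
triple-pair-loosens {β} 2 b 3≤β odd _ _ eq = ⊥-elim (odd (divides (3 + b) (trans eq (even b))))
  where
  even : ∀ b → 2 + (2 + (2 + (b + (b + 0)))) ≡ (3 + b) * 2
  even = solve 1 (λ b → con 2 :+ (con 2 :+ (con 2 :+ (b :+ (b :+ con 0)))) := (con 3 :+ b) :* con 2) refl
triple-pair-loosens {β} (suc (suc (suc k))) (suc b) 3≤β odd _ _ eq with suc b ≟ 2 + k
-- If b = a - 1, omitting a - 1 is impossible. One a becomes b instead: every letter is then
-- repeated, and the omitted difference is 1.
... | yes refl = 3 + k , 2 + k , (3 + k) ∷ (3 + k) ∷ (2 + k) ∷ (2 + k) ∷ [] , 0 , ↭-refl , trans (total k) (sym eq) ,
  omits-repeated ((2 + k) ∷ (3 + k) ∷ (3 + k) ∷ (2 + k) ∷ (2 + k) ∷ []) (λ y → full-house-count≢1 y (3 + k) (2 + k))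
    (λ { (here ()) ; (there (here ())) ; (there (there (here ()))) ; (there (there (there (here ()))))
       ; (there (there (there (there (here ()))))) })
    (λ { refl → <⇒≱ (s≤s z<s) 3≤β })
  where
  total : ∀ k → 1 + (2 + k + (3 + k + (3 + k + (2 + k + (2 + k + 0))))) ≡ 3 + k + (3 + k + (3 + k + (2 + k + (2 + k + 0))))
  total = solve 1 (λ k → con 1 :+ (con 2 :+ k :+ (con 3 :+ k :+ (con 3 :+ k :+ (con 2 :+ k :+ (con 2 :+ k :+ con 0)))))
    := con 3 :+ k :+ (con 3 :+ k :+ (con 3 :+ k :+ (con 2 :+ k :+ (con 2 :+ k :+ con 0))))) refl
-- Otherwise one a becomes 1 and a - 1 is omitted; it is not β, since 2(a - 1) + 5 < 3a + 2b.
... | no b≢ = 3 + k , 1 , (3 + k) ∷ (3 + k) ∷ suc b ∷ suc b ∷ [] , suc k , ↭-refl , trans (total k b) (sym eq) ,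
  omits-repeated-∷1 ((3 + k) ∷ (3 + k) ∷ suc b ∷ suc b ∷ []) (λ y → pairs-count≢1 y (3 + k) (suc b))
    (λ { (here eq) → 1+n≢n (sym eq) ; (there (here eq)) → 1+n≢n (sym eq)
       ; (there (there (here eq))) → b≢ (sym eq) ; (there (there (there (here eq)))) → b≢ (sym eq) })
    (s≤s z<s) (λ { refl → m≢1+m+n (2 + k + (2 + k) + 5) (trans eq (excess k b)) })
    (λ { refl → <⇒≱ (s≤s z<s) 3≤β })
  where
  total : ∀ k b → 2 + k + (1 + (3 + k + (3 + k + (suc b + (suc b + 0))))) ≡ 3 + k + (3 + k + (3 + k + (suc b + (suc b + 0))))
  total = solve 2 (λ k b → con 2 :+ k :+ (con 1 :+ (con 3 :+ k :+ (con 3 :+ k :+ (con 1 :+ b :+ (con 1 :+ b :+ con 0)))))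
    := con 3 :+ k :+ (con 3 :+ k :+ (con 3 :+ k :+ (con 1 :+ b :+ (con 1 :+ b :+ con 0))))) refl
  excess : ∀ k b → 3 + k + (3 + k + (3 + k + (suc b + (suc b + 0)))) ≡ suc (2 + k + (2 + k) + 5 + (1 + k + 2 * b))
  excess = solve 2 (λ k b → con 3 :+ k :+ (con 3 :+ k :+ (con 3 :+ k :+ (con 1 :+ b :+ (con 1 :+ b :+ con 0))))
    := con 1 :+ (con 2 :+ k :+ (con 2 :+ k) :+ con 5 :+ (con 1 :+ k :+ con 2 :* b))) refl

-- Five letters in blocks of at least 2 form a single block or blocks of 3 and 2, in either order.
loosen₆ : ∀ {β} → 3 ≤ β → ¬ 2 ∣ β + β + 5 → ∀ bs → length (expand bs) ≡ 5 → sum (expand bs) ≡ β + β + 5 →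
  0 ∉ expand bs → Loosens β (β + β + 5) (expand bs)
loosen₆ 3≤β odd ((0 , a) ∷ []) ()
loosen₆ 3≤β odd ((0 , a) ∷ (0 , b) ∷ []) ()
loosen₆ 3≤β odd ((0 , a) ∷ (0 , b) ∷ (_ , c) ∷ bs) ()
loosen₆ 3≤β odd ((0 , b) ∷ (1 , a) ∷ []) _ eq 0∉ =
  loosens-resp-↭ swapped (triple-pair-loosens a b 3≤β odd
    (n≢0⇒n>0 (λ { refl → 0∉ (there (there (here refl))) })) (n≢0⇒n>0 (λ { refl → 0∉ (here refl) }))
    (trans (sym eq) (sum-↭ swapped)))
  where
  swapped : b ∷ b ∷ a ∷ a ∷ a ∷ [] ↭ a ∷ a ∷ a ∷ b ∷ b ∷ []
  swapped = ↭.++-comm (b ∷ b ∷ []) (a ∷ a ∷ a ∷ [])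
loosen₆ 3≤β odd ((0 , a) ∷ (1 , b) ∷ (_ , c) ∷ bs) ()
loosen₆ 3≤β odd ((0 , a) ∷ (suc (suc j) , b) ∷ bs) ()
loosen₆ 3≤β odd ((1 , a) ∷ []) ()
loosen₆ 3≤β odd ((1 , a) ∷ (0 , b) ∷ []) _ eq 0∉ = triple-pair-loosens a b 3≤β odd
  (n≢0⇒n>0 (λ { refl → 0∉ (here refl) })) (n≢0⇒n>0 (λ { refl → 0∉ (there (there (there (here refl)))) }))
  (sym eq)
loosen₆ 3≤β odd ((1 , a) ∷ (0 , b) ∷ (_ , c) ∷ bs) ()
loosen₆ 3≤β odd ((1 , a) ∷ (suc j , b) ∷ bs) ()
loosen₆ 3≤β odd ((2 , a) ∷ []) ()
loosen₆ 3≤β odd ((2 , a) ∷ (_ , b) ∷ bs) ()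
loosen₆ 3≤β odd ((3 , a) ∷ []) _ eq _ = quintuple-loosens a 3≤β (sym eq)
loosen₆ 3≤β odd ((3 , a) ∷ (_ , b) ∷ bs) ()
loosen₆ 3≤β odd ((suc (suc (suc (suc j))) , a) ∷ bs) ()

-- The three values of t

parity : ∀ k → (∃ λ h → k ≡ h + h) ⊎ (∃ λ h → k ≡ suc (h + h))
parity zero = inj₁ (0 , refl)
parity (suc k) with parity k
... | inj₁ (h , refl) = inj₂ (h , refl)
... | inj₂ (h , refl) = inj₁ (suc h , cong suc (sym (+-suc h h)))

mcycle₃ : ∀ n → 5 ≤ n → gcd n 3 ≡ 1 → MCycleExists n 3
mcycle₃ (suc N) 5≤n g = mcycle-by-omission N 0 (pred ⌊ suc N /2⌋) (≤-trans (s≤s (s≤s (s≤s z≤n))) 5≤n) (simple₃ g)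
  (λ bs len s _ → loosen₃ 5≤n bs len s)

mcycle₄ : ∀ n → 5 ≤ n → gcd n 4 ≡ 1 → MCycleExists n 4
mcycle₄ (suc N) 5≤n g = mcycle-by-omission N 1 (suc (suc N)) (≤-trans (s≤s (s≤s (s≤s z≤n))) 5≤n) (simple₄ g)
  (λ bs len s _ → loosen₄ 5≤n g bs len s)

-- The bound 11 is what makes β at least 3, as the repairs for t = 6 require.
odd-form : ∀ n → 11 ≤ n → ¬ 2 ∣ n → ∃ λ β → 3 ≤ β × n ≡ β + β + 5
odd-form n 11≤n odd with k , refl ← m≤n⇒∃[o]m+o≡n 11≤n with parity k
... | inj₁ (h , refl) = 3 + h , s≤s (s≤s (s≤s z≤n)) ,
  solve 1 (λ h → con 11 :+ (h :+ h) := con 3 :+ h :+ (con 3 :+ h) :+ con 5) refl h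
... | inj₂ (h , refl) = ⊥-elim (odd (divides (6 + h)
  (solve 1 (λ h → con 11 :+ (con 1 :+ (h :+ h)) := (con 6 :+ h) :* con 2) refl h)))

mcycle₆ : ∀ n → 11 ≤ n → gcd n 6 ≡ 1 → MCycleExists n 6
mcycle₆ n@(suc N) 11≤n g = mcycle-by-omission N 3 β (≤-trans (s≤s (s≤s (s≤s z≤n))) 11≤n) (simple₆ g)
  (λ bs len s 0∉ → subst (λ m → Loosens β m (expand bs)) (sym n≡)
    (loosen₆ 3≤β (subst (λ m → ¬ 2 ∣ m) n≡ odd) bs len (trans s n≡) 0∉))
  where
  odd : ¬ 2 ∣ n
  odd = common-divisor 0 g (divides 3 refl)
  β : ℕ
  β = proj₁ (odd-form n 11≤n odd)
  3≤β : 3 ≤ β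
  3≤β = proj₁ (proj₂ (odd-form n 11≤n odd))
  n≡ : n ≡ β + β + 5
  n≡ = proj₂ (proj₂ (odd-form n 11≤n odd))

-- For n = 4 the word 2 2 of differences has no neighbour, so this case is listed.
sequence₄₃ : Vec.Vec (Fin 4) 20
sequence₄₃ = # 0 ∷ # 0 ∷ # 0 ∷ # 1 ∷ # 1 ∷ # 1 ∷ # 2 ∷ # 0 ∷ # 2 ∷ # 0 ∷
  # 3 ∷ # 1 ∷ # 3 ∷ # 1 ∷ # 2 ∷ # 2 ∷ # 2 ∷ # 3 ∷ # 3 ∷ # 3 ∷ []

-- Base 4 digits count the multiplicities, which are at most 3.
encode : List (Fin 4) → ℕ
encode xs = sum (map (λ x → 4 ^ toℕ x) xs)

encode-↭ : ∀ {xs ys} → xs ↭ ys → encode xs ≡ encode ys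
encode-↭ p = sum-↭ (↭.map⁺ (λ x → 4 ^ toℕ x) p)

mcycle₄₃ : MCycleExists 4 3
mcycle₄₃ = mcycle-of-length {4} {3} {20} refl (Vec.lookup sequence₄₃ , λ i j i≢j p → distinct i j i≢j (encode-↭ p))
  where
  distinct : ∀ i j → i ≢ j → encode (window 3 (Vec.lookup sequence₄₃) i) ≢ encode (window 3 (Vec.lookup sequence₄₃) j)
  distinct = from-yes (Fin.all? λ i → Fin.all? λ j → ¬? (i Fin.≟ j) →-dec
    ¬? (encode (window 3 (Vec.lookup sequence₄₃) i) ≟ encode (window 3 (Vec.lookup sequence₄₃) j)))

theorem2 : (t : ℕ) → (t ≡ 3 ⊎ t ≡ 4 ⊎ t ≡ 6) →
    (n : ℕ) → n₀ t ≤ n → gcd n t ≡ 1 → MCycleExists n t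
theorem2 .3 (inj₁ refl) n 4≤n g with m≤n⇒m<n∨m≡n 4≤n
... | inj₁ 5≤n     = mcycle₃ n 5≤n g
... | inj₂ refl = mcycle₄₃
theorem2 .4 (inj₂ (inj₁ refl)) n 5≤n g = mcycle₄ n 5≤n g
theorem2 .6 (inj₂ (inj₂ refl)) n 11≤n g = mcycle₆ n 11≤n g
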